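{- For every positive integer $h$ and every even positive integer $k$ there exist $\varepsilon>0$ and $N$ such that every finite group $\Gamma$ with $|\Gamma|\ge N$ containing a normal abelian subgroup $H$ of index $|\Gamma:H|=h$ satisfies $$M_k(\Gamma)\le(1-\varepsilon)|\Gamma|^{1/k}.$$
   Context: For a group $\Gamma$, $A\subseteq\Gamma$ is an $S_k$-set if whenever $\alpha_1\cdots\alpha_k=\beta_1\cdots\beta_k$ with all $\alpha_i,\beta_i\in A$, we have $(\alpha_1,\ldots,\alpha_k)=(\beta_1,\ldots,\beta_k)$. $M_k(\Gamma)$ denotes the maximum size of an $S_k$-set in $\Gamma$. -}

module Defs where

open import Data.Nat using (ℕ; zero; suc; _*_; _≤_)
open import Data.Fin using (Fin; zero; suc)
open import Data.Fin.Subset using (Subset; _∈_; ∣_∣)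
open import Algebra.Structures using (IsGroup)
open import Relation.Binary.PropositionalEquality using (_≡_)

-- A finite group of order n, presented (up to isomorphism) on the carrier Fin n
-- with propositional equality.
record FinGroup (n : ℕ) : Set where
  field
    _∙_     : Fin n → Fin n → Fin n
    e       : Fin n
    inv     : Fin n → Fin n
    isGroup : IsGroup _≡_ _∙_ e inv

module _ {n : ℕ} (G : FinGroup n) where
  open FinGroup G

  prod : (k : ℕ) → (Fin k → Fin n) → Fin n
  prod zero    a = e
  prod (suc k) a = a zero ∙ prod k (λ i → a (suc i))

  IsNormalAbelianSubgroup : Subset n → Set
  IsNormalAbelianSubgroup H =
    (e ∈ H)
    × (∀ x y → x ∈ H → y ∈ H → (x ∙ y) ∈ H)
    × (∀ x → x ∈ H → inv x ∈ H)
    × (∀ g x → x ∈ H → ((g ∙ x) ∙ inv g) ∈ H)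
    × (∀ x y → x ∈ H → y ∈ H → (x ∙ y) ≡ (y ∙ x))
    where open import Data.Product using (_×_)

  IsSk : ℕ → Subset n → Set
  IsSk k A = (a b : Fin k → Fin n) → (∀ i → a i ∈ A) → (∀ i → b i ∈ A) →
             prod k a ≡ prod k b → ∀ i → a i ≡ b i

{-# OPTIONS --safe #-}
module Submission where

open import Defs
open import Algebra.Bundles using (CommutativeRing; Group)
open import Algebra.Structures using (IsGroup)
import Algebra.Properties.Group as GroupProperties
open import Data.Bool using (Bool; true; false)
open import Data.Bool.Properties using (¬-not)
open import Data.Fin using (Fin; zero; suc; splitAt; combine; finToFun; funToFin)
open import Data.Fin.Permutation using (permutation)
open import Data.Fin.Properties using (any?; suc-injective; funToFin-finToFin) renaming (_≟_ to _≟ᶠ_)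
open import Data.Fin.Subset using (Subset; _∈_; ∣_∣)
open import Data.Fin.Subset.Properties using (_∈?_)
open import Data.Maybe using (Maybe; just; nothing)
import Data.Nat as ℕ
open import Data.Nat using (ℕ; zero; suc)
import Data.Nat.Properties as ℕₚ
import Data.Nat.Tactic.RingSolver as ℕ-solver
open import Data.Product using (Σ; _×_; _,_; proj₁; proj₂)
open import Data.Sum using (inj₁; inj₂)
open import Data.Vec using (lookup; []; _∷_; here; there)
open import Data.Vec.Functional using (_++_)
open import Data.Vec.Functional.Properties using (++-injectiveˡ; ++-injectiveʳ)
open import Data.Vec.Properties using ([]=⇒lookup; lookup⇒[]=)
open import Function using (_∘_)
open import Level using (0ℓ)
open import Relation.Binary.PropositionalEquality
open import Relation.Nullary using (Dec; yes; no; ¬_; contradiction; does)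

-- Write k = 2m. Products of m-letter words over A form an S₂-family b of size s = |A|^m, so it
-- suffices to bound s² by (1 - ε)n. Let M be the convolution operator on Γ of the function
-- g ↦ h |{ i : bᵢ ∈ gH }| - s, which has mean 0. Two members of b in the abelian group H would
-- commute, so at most one lies there and the trace of M is very negative. If s² were close to n,
-- then products bᵢbⱼ would be equidistributed among the cosets of H, so M² would be close to 0.
-- But a matrix of bounded rank (here h) and nearly vanishing square has small trace. In the exact
-- case tr M = tr (EM) = tr (ME) = 0 for E the projection onto the image of M; E is approximated
-- by 1 - (1 - MMᵀ)^r, which needs no spectral theory.

-- M need not be normal, so M² near 0 does not make M small, and only the trace can be controlled.
-- Let `y r` = (1 - MMᵀ)^r M be the part of M that the approximate projection has not yet captured.
-- One step changes its trace by -⟨M, (1 - MMᵀ)^r M²⟩, so by at most ‖M²‖, and tr `y r` stays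
-- negative for many steps. Bounded rank says that a large trace forces a large norm. This is used
-- twice: for `y r`, and for Mᵀ `y (r + r)`, whose trace is ‖`y r`‖² and whose squared norm bounds
-- from below what the next step removes from ‖`y (r + r)`‖². Every two steps thus cost at least t⁴
-- / h³, and too many of them would exhaust ‖M‖² ≤ 1. The number of steps is fixed in terms of h
-- alone before the closeness of s² to n is prescribed, which keeps ε uniform in Γ. Everything stays
-- in ℚ because only squares of norms are compared.

module Rational where

  open import Data.Rational hiding (∣_∣)
  open import Data.Rational.Properties
  open import Algebra.Properties.Semiring.Sum (CommutativeRing.semiring +-*-commutativeRing)
  open import Tactic.RingSolver using (solve-∀)
  open import Tactic.RingSolver.Core.AlmostCommutativeRing using (AlmostCommutativeRing; fromCommutativeRing)

  -- Rational arithmetic, finite sums and Cauchy-Schwarz.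

  ring : AlmostCommutativeRing 0ℓ 0ℓ
  ring = fromCommutativeRing +-*-commutativeRing isZero
    where
    isZero : (x : ℚ) → Maybe (0ℚ ≡ x)
    isZero x with 0ℚ ≟ x
    ... | yes p = just p
    ... | no  _ = nothing

  -- Brings polynomial inequalities within reach of the ring solver: the remainder `c` is an
  -- explicit expression that is visibly nonnegative.
  ≤-of-≡+ : ∀ {a b c} → 0ℚ ≤ c → b ≡ a + c → a ≤ b
  ≤-of-≡+ {a} {b} {c} 0≤c eq = begin
    a       ≡⟨ sym (+-identityʳ a) ⟩
    a + 0ℚ  ≤⟨ +-monoʳ-≤ a 0≤c ⟩
    a + c   ≡⟨ sym eq ⟩
    b       ∎
    where open ≤-Reasoning

  p≤q⇒0≤q-p : ∀ {p q} → p ≤ q → 0ℚ ≤ q - p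
  p≤q⇒0≤q-p {p} {q} p≤q = begin
    0ℚ     ≡⟨ sym (+-inverseʳ p) ⟩
    p - p  ≤⟨ +-monoˡ-≤ (- p) p≤q ⟩
    q - p  ∎
    where open ≤-Reasoning

  +-nonneg : ∀ {a b} → 0ℚ ≤ a → 0ℚ ≤ b → 0ℚ ≤ a + b
  +-nonneg 0≤a 0≤b = +-mono-≤ 0≤a 0≤b

  *-nonneg : ∀ {a b} → 0ℚ ≤ a → 0ℚ ≤ b → 0ℚ ≤ a * b
  *-nonneg {a} {b} 0≤a 0≤b = begin
    0ℚ      ≡⟨ sym (*-zeroˡ b) ⟩
    0ℚ * b  ≤⟨ *-monoʳ-≤-nonNeg b {{nonNegative 0≤b}} 0≤a ⟩
    a * b   ∎
    where open ≤-Reasoning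

  *-monoˡ : ∀ {a b c} → 0ℚ ≤ c → a ≤ b → c * a ≤ c * b
  *-monoˡ {c = c} 0≤c = *-monoˡ-≤-nonNeg c {{nonNegative 0≤c}}

  *-monoʳ : ∀ {a b c} → 0ℚ ≤ c → a ≤ b → a * c ≤ b * c
  *-monoʳ {c = c} 0≤c = *-monoʳ-≤-nonNeg c {{nonNegative 0≤c}}

  *-mono : ∀ {a b c d} → 0ℚ ≤ a → a ≤ b → 0ℚ ≤ c → c ≤ d → a * c ≤ b * d
  *-mono 0≤a a≤b 0≤c c≤d = ≤-trans (*-monoʳ 0≤c a≤b) (*-monoˡ (≤-trans 0≤a a≤b) c≤d)

  square-mono : ∀ {a b} → 0ℚ ≤ a → a ≤ b → a * a ≤ b * b
  square-mono 0≤a a≤b = *-mono 0≤a a≤b 0≤a a≤b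

  neg-square : ∀ x → - x * - x ≡ x * x
  neg-square = solve-∀ ring

  square-* : ∀ x y → (x * y) * (x * y) ≡ (x * x) * (y * y)
  square-* = solve-∀ ring

  *-distribʳ-- : ∀ a b c → (a - b) * c ≡ a * c - b * c
  *-distribʳ-- = solve-∀ ring

  0≤square : ∀ x → 0ℚ ≤ x * x
  0≤square x with ≤-total 0ℚ x
  ... | inj₁ 0≤x = *-nonneg 0≤x 0≤x
  ... | inj₂ x≤0 = subst (0ℚ ≤_) (neg-square x) (*-nonneg 0≤-x 0≤-x)
    where
    0≤-x : 0ℚ ≤ - x
    0≤-x = neg-antimono-≤ x≤0

  <⇒≱ : ∀ {p q} → p < q → ¬ q ≤ p
  <⇒≱ p<q q≤p = <-irrefl refl (<-≤-trans p<q q≤p)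

  -- Stands in for square roots after Cauchy-Schwarz.
  square-cancel-≤ : ∀ {a b} → 0ℚ ≤ b → a * a ≤ b * b → a ≤ b
  square-cancel-≤ {a} {b} 0≤b a²≤b² with a ≤? b
  ... | yes a≤b = a≤b
  ... | no  a≰b = contradiction a²≤b² (<⇒≱ b²<a²)
    where
    b<a = ≰⇒> a≰b
    0<a = ≤-<-trans 0≤b b<a
    b²<a² : b * b < a * a
    b²<a² = ≤-<-trans (*-monoˡ 0≤b (<⇒≤ b<a)) (*-monoˡ-<-pos a {{positive 0<a}} b<a)

  -- Recursive, so that `ι (suc n)` unfolds to `1ℚ + ι n` and inductions on `n` match the sums over
  -- `Fin n`.
  ι : ℕ → ℚ
  ι zero    = 0ℚ
  ι (suc n) = 1ℚ + ι n

  0≤1 : 0ℚ ≤ 1ℚ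
  0≤1 = nonNegative⁻¹ 1ℚ

  ι-nonneg : ∀ n → 0ℚ ≤ ι n
  ι-nonneg zero    = ≤-refl
  ι-nonneg (suc n) = +-nonneg 0≤1 (ι-nonneg n)

  ι-mono : ∀ {m n} → m ℕ.≤ n → ι m ≤ ι n
  ι-mono {n = n} ℕ.z≤n = ι-nonneg n
  ι-mono (ℕ.s≤s m≤n) = +-monoʳ-≤ 1ℚ (ι-mono m≤n)

  ι-pos : ∀ {n} → 1 ℕ.≤ n → 0ℚ < ι n
  ι-pos {suc n} _ = <-≤-trans (positive⁻¹ 1ℚ) (≤-of-≡+ (ι-nonneg n) refl)

  ι-+ : ∀ m n → ι (m ℕ.+ n) ≡ ι m + ι n
  ι-+ zero    n = sym (+-identityˡ (ι n))
  ι-+ (suc m) n = trans (cong (1ℚ +_) (ι-+ m n)) (sym (+-assoc 1ℚ (ι m) (ι n)))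

  suc-* : ∀ x y → y + x * y ≡ (1ℚ + x) * y
  suc-* = solve-∀ ring

  ι-* : ∀ m n → ι (m ℕ.* n) ≡ ι m * ι n
  ι-* zero    n = sym (*-zeroˡ (ι n))
  ι-* (suc m) n = trans (ι-+ n (m ℕ.* n)) (trans (cong (ι n +_) (ι-* m n)) (suc-* (ι m) (ι n)))

  sum-mono : ∀ {n} {f g : Fin n → ℚ} → (∀ i → f i ≤ g i) → sum f ≤ sum g
  sum-mono {zero}  f≤g = ≤-refl
  sum-mono {suc n} f≤g = +-mono-≤ (f≤g zero) (sum-mono (λ i → f≤g (suc i)))

  sum-const : ∀ n c → sum {n} (λ _ → c) ≡ ι n * c
  sum-const zero    c = sym (*-zeroˡ c)
  sum-const (suc n) c = trans (cong (c +_) (sum-const n c)) (suc-* (ι n) c)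

  sum-0 : ∀ {n} {f : Fin n → ℚ} → (∀ i → f i ≡ 0ℚ) → sum f ≡ 0ℚ
  sum-0 {n} eq = trans (sum-cong-≗ eq) (trans (sum-const n 0ℚ) (*-zeroʳ (ι n)))

  sum-nonneg : ∀ {n} {f : Fin n → ℚ} → (∀ i → 0ℚ ≤ f i) → 0ℚ ≤ sum f
  sum-nonneg {zero}  _   = ≤-refl
  sum-nonneg {suc n} 0≤f = +-nonneg (0≤f zero) (sum-nonneg (λ i → 0≤f (suc i)))

  sum-- : ∀ {n} (f g : Fin n → ℚ) → sum (λ i → f i - g i) ≡ sum f - sum g
  sum-- {zero}  f g = refl
  sum-- {suc n} f g =
    trans (cong (f zero - g zero +_) (sum-- (λ i → f (suc i)) (λ i → g (suc i))))
          (regroup (f zero) (g zero) _ _)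
    where
    regroup : ∀ a b c d → (a - b) + (c - d) ≡ (a + c) - (b + d)
    regroup = solve-∀ ring

  sum-swap₁₃ : ∀ {l m n} (f : Fin l → Fin m → Fin n → ℚ) →
    sum (λ i → sum λ j → sum λ k → f i j k) ≡ sum (λ k → sum λ j → sum λ i → f i j k)
  sum-swap₁₃ f = begin
    sum (λ i → sum λ j → sum λ k → f i j k)  ≡⟨ sum-cong-≗ (λ i → ∑-comm (f i)) ⟩
    sum (λ i → sum λ k → sum λ j → f i j k)  ≡⟨ ∑-comm (λ i k → sum λ j → f i j k) ⟩
    sum (λ k → sum λ i → sum λ j → f i j k)  ≡⟨ sum-cong-≗ (λ k → ∑-comm (λ i j → f i j k)) ⟩
    sum (λ k → sum λ j → sum λ i → f i j k)  ∎
    where open ≡-Reasoning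

  -- Cauchy–Schwarz, in a form that iterates to multiple sums.
  sum-square-≤ : ∀ {n} (p u v : Fin n → ℚ) → (∀ i → 0ℚ ≤ u i) → (∀ i → 0ℚ ≤ v i) →
    (∀ i → p i * p i ≤ u i * v i) → sum p * sum p ≤ sum u * sum v
  sum-square-≤ {zero}  p u v 0≤u 0≤v p²≤uv = ≤-refl
  sum-square-≤ {suc n} p u v 0≤u 0≤v p²≤uv = begin
    (p₀ + P) * (p₀ + P)                      ≡⟨ expand p₀ P ⟩
    p₀ * p₀ + P * P + (p₀ * P + p₀ * P)      ≤⟨ +-mono-≤ (+-mono-≤ (p²≤uv zero) IH) cross ⟩
    u₀ * v₀ + U * V + (u₀ * V + U * v₀)      ≡⟨ collect u₀ v₀ U V ⟩
    (u₀ + U) * (v₀ + V)                      ∎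
    where
    open ≤-Reasoning
    p₀ = p zero
    u₀ = u zero
    v₀ = v zero
    P = sum (λ i → p (suc i))
    U = sum (λ i → u (suc i))
    V = sum (λ i → v (suc i))
    0≤U : 0ℚ ≤ U
    0≤U = sum-nonneg (λ i → 0≤u (suc i))
    0≤V : 0ℚ ≤ V
    0≤V = sum-nonneg (λ i → 0≤v (suc i))
    IH : P * P ≤ U * V
    IH = sum-square-≤ _ _ _ (λ i → 0≤u (suc i)) (λ i → 0≤v (suc i)) (λ i → p²≤uv (suc i))
    expand : ∀ a b → (a + b) * (a + b) ≡ a * a + b * b + (a * b + a * b)
    expand = solve-∀ ring
    collect : ∀ a b c d → a * b + c * d + (a * d + c * b) ≡ (a + c) * (b + d)
    collect = solve-∀ ring
    square₂ : ∀ a b → (a * b + a * b) * (a * b + a * b) ≡ (1ℚ + 1ℚ + 1ℚ + 1ℚ) * ((a * a) * (b * b))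
    square₂ = solve-∀ ring
    am-gm : ∀ a b c d → (a * d + c * b) * (a * d + c * b) ≡
      (1ℚ + 1ℚ + 1ℚ + 1ℚ) * ((a * b) * (c * d)) + (a * d - c * b) * (a * d - c * b)
    am-gm = solve-∀ ring
    -- AM-GM after squaring: 4 p₀²P² ≤ 4 (u₀v₀)(UV) ≤ (u₀V + Uv₀)².
    cross : p₀ * P + p₀ * P ≤ u₀ * V + U * v₀
    cross = square-cancel-≤ (+-nonneg (*-nonneg (0≤u zero) 0≤V) (*-nonneg 0≤U (0≤v zero))) (begin
      (p₀ * P + p₀ * P) * (p₀ * P + p₀ * P)              ≡⟨ square₂ p₀ P ⟩
      (1ℚ + 1ℚ + 1ℚ + 1ℚ) * ((p₀ * p₀) * (P * P))
        ≤⟨ *-monoˡ (nonNegative⁻¹ (1ℚ + 1ℚ + 1ℚ + 1ℚ)) (*-mono (0≤square p₀) (p²≤uv zero) (0≤square P) IH) ⟩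
      (1ℚ + 1ℚ + 1ℚ + 1ℚ) * ((u₀ * v₀) * (U * V))
        ≤⟨ ≤-of-≡+ (0≤square (u₀ * V - U * v₀)) (am-gm u₀ v₀ U V) ⟩
      (u₀ * V + U * v₀) * (u₀ * V + U * v₀)              ∎)

  -- Matrices and the descent argument

  module _ {n : ℕ} where

    Mat : Set
    Mat = Fin n → Fin n → ℚ

    infix 4 _≐_
    infixl 6 _⊖_
    infixl 7 _⊗_

    _≐_ : Mat → Mat → Set
    A ≐ B = ∀ i j → A i j ≡ B i j

    _⊗_ _⊖_ : Mat → Mat → Mat
    (A ⊗ B) i j = sum λ k → A i k * B k j
    (A ⊖ B) i j = A i j - B i j

    _ᵀ : Mat → Mat
    (A ᵀ) i j = A j i

    ⟨_,_⟩ : Mat → Mat → ℚ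
    ⟨ A , B ⟩ = sum λ i → sum λ j → A i j * B i j

    ‖_‖² : Mat → ℚ
    ‖ A ‖² = ⟨ A , A ⟩

    tr : Mat → ℚ
    tr A = sum λ i → A i i

    ≐-trans : ∀ {A B C} → A ≐ B → B ≐ C → A ≐ C
    ≐-trans A≐B B≐C i j = trans (A≐B i j) (B≐C i j)

    ⊗-cong : ∀ {A A′ B B′} → A ≐ A′ → B ≐ B′ → A ⊗ B ≐ A′ ⊗ B′
    ⊗-cong A≐ B≐ i j = sum-cong-≗ λ k → cong₂ _*_ (A≐ i k) (B≐ k j)

    ⟨⟩-cong : ∀ {A A′ B B′} → A ≐ A′ → B ≐ B′ → ⟨ A , B ⟩ ≡ ⟨ A′ , B′ ⟩
    ⟨⟩-cong A≐ B≐ = sum-cong-≗ λ i → sum-cong-≗ λ j → cong₂ _*_ (A≐ i j) (B≐ i j)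

    tr-cong : ∀ {A B} → A ≐ B → tr A ≡ tr B
    tr-cong A≐B = sum-cong-≗ λ i → A≐B i i

    ⟨⟩-comm : ∀ A B → ⟨ A , B ⟩ ≡ ⟨ B , A ⟩
    ⟨⟩-comm A B = sum-cong-≗ λ i → sum-cong-≗ λ j → *-comm (A i j) (B i j)

    ⟨⟩-⊖ˡ : ∀ A B C → ⟨ A ⊖ B , C ⟩ ≡ ⟨ A , C ⟩ - ⟨ B , C ⟩
    ⟨⟩-⊖ˡ A B C = trans
      (sum-cong-≗ λ i → trans (sum-cong-≗ λ j → *-distribʳ-- (A i j) (B i j) (C i j))
        (sum-- (λ j → A i j * C i j) (λ j → B i j * C i j)))
      (sum-- (λ i → sum λ j → A i j * C i j) (λ i → sum λ j → B i j * C i j))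

    ⟨⟩-⊖ʳ : ∀ A B C → ⟨ A , B ⊖ C ⟩ ≡ ⟨ A , B ⟩ - ⟨ A , C ⟩
    ⟨⟩-⊖ʳ A B C = begin
      ⟨ A , B ⊖ C ⟩          ≡⟨ ⟨⟩-comm A (B ⊖ C) ⟩
      ⟨ B ⊖ C , A ⟩          ≡⟨ ⟨⟩-⊖ˡ B C A ⟩
      ⟨ B , A ⟩ - ⟨ C , A ⟩  ≡⟨ cong₂ _-_ (⟨⟩-comm B A) (⟨⟩-comm C A) ⟩
      ⟨ A , B ⟩ - ⟨ A , C ⟩  ∎
      where open ≡-Reasoning

    ⊗-distribʳ-⊖ : ∀ A B C → (A ⊖ B) ⊗ C ≐ A ⊗ C ⊖ B ⊗ C
    ⊗-distribʳ-⊖ A B C i j =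
      trans (sum-cong-≗ λ k → *-distribʳ-- (A i k) (B i k) (C k j))
        (sum-- (λ k → A i k * C k j) (λ k → B i k * C k j))

    ⊗-assoc : ∀ A B C → (A ⊗ B) ⊗ C ≐ A ⊗ (B ⊗ C)
    ⊗-assoc A B C i j = begin
      sum (λ k → sum (λ l → A i l * B l k) * C k j)
        ≡⟨ sum-cong-≗ (λ k → *-distribʳ-sum (C k j) (λ l → A i l * B l k)) ⟩
      sum (λ k → sum λ l → A i l * B l k * C k j)
        ≡⟨ ∑-comm (λ k l → A i l * B l k * C k j) ⟩
      sum (λ l → sum λ k → A i l * B l k * C k j)
        ≡⟨ sum-cong-≗ (λ l → sum-cong-≗ λ k → *-assoc (A i l) (B l k) (C k j)) ⟩
      sum (λ l → sum λ k → A i l * (B l k * C k j))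
        ≡⟨ sum-cong-≗ (λ l → sym (*-distribˡ-sum (A i l) (λ k → B l k * C k j))) ⟩
      sum (λ l → A i l * sum (λ k → B l k * C k j)) ∎
      where open ≡-Reasoning

    ⊗-adjoint : ∀ A B C → ⟨ A ⊗ B , C ⟩ ≡ ⟨ B , A ᵀ ⊗ C ⟩
    ⊗-adjoint A B C = begin
      sum (λ i → sum λ j → sum (λ k → A i k * B k j) * C i j)
        ≡⟨ sum-cong-≗ (λ i → sum-cong-≗ λ j → *-distribʳ-sum (C i j) (λ k → A i k * B k j)) ⟩
      sum (λ i → sum λ j → sum λ k → A i k * B k j * C i j)
        ≡⟨ sum-swap₁₃ (λ i j k → A i k * B k j * C i j) ⟩
      sum (λ k → sum λ j → sum λ i → A i k * B k j * C i j)
        ≡⟨ sum-cong-≗ (λ k → sum-cong-≗ λ j → sum-cong-≗ λ i → swap (A i k) (B k j) (C i j)) ⟩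
      sum (λ k → sum λ j → sum λ i → B k j * (A i k * C i j))
        ≡⟨ sum-cong-≗ (λ k → sum-cong-≗ λ j → sym (*-distribˡ-sum (B k j) (λ i → A i k * C i j))) ⟩
      sum (λ k → sum λ j → B k j * sum (λ i → A i k * C i j)) ∎
      where
      open ≡-Reasoning
      swap : ∀ a b c → a * b * c ≡ b * (a * c)
      swap = solve-∀ ring

    -- Cyclicity of the trace. Moving `A` to the far right is what puts two factors M side by side
    -- in the descent.
    tr-⊗-⊗ᵀ : ∀ A B C → tr (A ⊗ (B ᵀ ⊗ C)) ≡ ⟨ B , C ⊗ A ⟩
    tr-⊗-⊗ᵀ A B C = begin
      sum (λ i → sum λ k → A i k * sum (λ l → B l k * C l i))
        ≡⟨ sum-cong-≗ (λ i → sum-cong-≗ λ k → *-distribˡ-sum (A i k) (λ l → B l k * C l i)) ⟩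
      sum (λ i → sum λ k → sum λ l → A i k * (B l k * C l i))
        ≡⟨ sum-swap₁₃ (λ i k l → A i k * (B l k * C l i)) ⟩
      sum (λ l → sum λ k → sum λ i → A i k * (B l k * C l i))
        ≡⟨ sum-cong-≗ (λ l → sum-cong-≗ λ k → sum-cong-≗ λ i → swap (A i k) (B l k) (C l i)) ⟩
      sum (λ l → sum λ k → sum λ i → B l k * (C l i * A i k))
        ≡⟨ sum-cong-≗ (λ l → sum-cong-≗ λ k → sym (*-distribˡ-sum (B l k) (λ i → C l i * A i k))) ⟩
      sum (λ l → sum λ k → B l k * sum (λ i → C l i * A i k)) ∎
      where
      open ≡-Reasoning
      swap : ∀ a b c → a * (b * c) ≡ b * (c * a)
      swap = solve-∀ ring

    ‖‖²-nonneg : ∀ A → 0ℚ ≤ ‖ A ‖²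
    ‖‖²-nonneg A = sum-nonneg λ i → sum-nonneg λ j → 0≤square (A i j)

    cauchy-schwarz : ∀ A B → ⟨ A , B ⟩ * ⟨ A , B ⟩ ≤ ‖ A ‖² * ‖ B ‖²
    cauchy-schwarz A B = sum-square-≤ _ _ _
      (λ i → sum-nonneg λ j → 0≤square (A i j)) (λ i → sum-nonneg λ j → 0≤square (B i j))
      λ i → sum-square-≤ _ _ _ (λ j → 0≤square (A i j)) (λ j → 0≤square (B i j))
        λ j → ≤-reflexive (square-* (A i j) (B i j))

    -- Cauchy-Schwarz bounds each entry by a row of `A` times a column of `B`; the double sum then
    -- factors.
    ‖⊗‖² : ∀ A B → ‖ A ⊗ B ‖² ≤ ‖ A ‖² * ‖ B ‖²
    ‖⊗‖² A B = begin
      sum (λ i → sum λ j → (A ⊗ B) i j * (A ⊗ B) i j)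
        ≤⟨ sum-mono (λ i → sum-mono λ j → sum-square-≤ _ _ _
             (λ k → 0≤square (A i k)) (λ k → 0≤square (B k j))
             λ k → ≤-reflexive (square-* (A i k) (B k j))) ⟩
      sum (λ i → sum λ j → row i * col j)
        ≡⟨ sum-cong-≗ (λ i → sym (*-distribˡ-sum (row i) col)) ⟩
      sum (λ i → row i * sum col)
        ≡⟨ sym (*-distribʳ-sum (sum col) row) ⟩
      sum row * sum col
        ≡⟨ cong (sum row *_) (∑-comm (λ j k → B k j * B k j)) ⟩
      ‖ A ‖² * ‖ B ‖² ∎
      where
      open ≤-Reasoning
      row col : Fin n → ℚ
      row i = sum λ k → A i k * A i k
      col j = sum λ k → B k j * B k j

    module Descent (M : Mat) (‖M‖²≤1 : ‖ M ‖² ≤ 1ℚ) where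

      -- Left multiplication by 1 - MMᵀ, kept as an operation on `Y` so that no identity matrix or
      -- matrix power is needed.
      step : Mat → Mat
      step Y = Y ⊖ M ⊗ (M ᵀ ⊗ Y)

      iter : ℕ → Mat → Mat
      iter zero    Y = Y
      iter (suc r) Y = step (iter r Y)

      step-cong : ∀ {Y Z} → Y ≐ Z → step Y ≐ step Z
      step-cong Y≐Z i j = cong₂ _-_ (Y≐Z i j)
        (⊗-cong {A = M} (λ _ _ → refl) (⊗-cong {A = M ᵀ} (λ _ _ → refl) Y≐Z) i j)

      iter-cong : ∀ r {Y Z} → Y ≐ Z → iter r Y ≐ iter r Z
      iter-cong zero    Y≐Z = Y≐Z
      iter-cong (suc r) Y≐Z = step-cong (iter-cong r Y≐Z)

      step-⊗ : ∀ Y B → step Y ⊗ B ≐ step (Y ⊗ B)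
      step-⊗ Y B = ≐-trans (⊗-distribʳ-⊖ Y (M ⊗ (M ᵀ ⊗ Y)) B) λ i j →
        cong (λ x → (Y ⊗ B) i j - x) (≐-trans (⊗-assoc M (M ᵀ ⊗ Y) B)
          (⊗-cong {A = M} (λ _ _ → refl) (⊗-assoc (M ᵀ) Y B)) i j)

      -- Left and right multiplications commute. With `B` = E this preserves the rank condition
      -- along the iteration; with `B` = M it turns (1 - MMᵀ)^r M · M into an iterate of the small
      -- matrix M².
      iter-⊗ : ∀ r Y B → iter r Y ⊗ B ≐ iter r (Y ⊗ B)
      iter-⊗ zero    Y B = λ _ _ → refl
      iter-⊗ (suc r) Y B = ≐-trans (step-⊗ (iter r Y) B) (step-cong (iter-⊗ r Y B))

      ⟨step,⟩ : ∀ Y Z → ⟨ step Y , Z ⟩ ≡ ⟨ Y , step Z ⟩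
      ⟨step,⟩ Y Z = begin
        ⟨ step Y , Z ⟩                               ≡⟨ ⟨⟩-⊖ˡ Y _ Z ⟩
        ⟨ Y , Z ⟩ - ⟨ M ⊗ (M ᵀ ⊗ Y) , Z ⟩            ≡⟨ cong (λ x → ⟨ Y , Z ⟩ - x) middle ⟩
        ⟨ Y , Z ⟩ - ⟨ Y , M ⊗ (M ᵀ ⊗ Z) ⟩            ≡⟨ sym (⟨⟩-⊖ʳ Y Z _) ⟩
        ⟨ Y , step Z ⟩                               ∎
        where
        open ≡-Reasoning
        middle : ⟨ M ⊗ (M ᵀ ⊗ Y) , Z ⟩ ≡ ⟨ Y , M ⊗ (M ᵀ ⊗ Z) ⟩
        middle = trans (⊗-adjoint M (M ᵀ ⊗ Y) Z) (⊗-adjoint (M ᵀ) Y (M ᵀ ⊗ Z))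

      iter-step : ∀ r Y → iter r (step Y) ≡ step (iter r Y)
      iter-step zero    Y = refl
      iter-step (suc r) Y = cong step (iter-step r Y)

      iter-+ : ∀ r s Y → iter (r ℕ.+ s) Y ≡ iter r (iter s Y)
      iter-+ zero    s Y = refl
      iter-+ (suc r) s Y = cong step (iter-+ r s Y)

      ⟨iter,⟩ : ∀ r Y Z → ⟨ iter r Y , Z ⟩ ≡ ⟨ Y , iter r Z ⟩
      ⟨iter,⟩ zero    Y Z = refl
      ⟨iter,⟩ (suc r) Y Z = begin
        ⟨ step (iter r Y) , Z ⟩  ≡⟨ ⟨step,⟩ (iter r Y) Z ⟩
        ⟨ iter r Y , step Z ⟩    ≡⟨ ⟨iter,⟩ r Y (step Z) ⟩
        ⟨ Y , iter r (step Z) ⟩  ≡⟨ cong ⟨ Y ,_⟩ (iter-step r Z) ⟩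
        ⟨ Y , step (iter r Z) ⟩  ∎
        where open ≡-Reasoning

      -- The left norm expands to ‖Y‖² - 2w + v, where v ≤ w by submultiplicativity and ‖M‖² ≤ 1; so
      -- at least one w is lost.
      ‖step‖² : ∀ Y → ‖ step Y ‖² + ‖ M ᵀ ⊗ Y ‖² ≤ ‖ Y ‖²
      ‖step‖² Y = begin
        ‖ step Y ‖² + w                            ≡⟨ cong (_+ w) expand ⟩
        (‖ Y ‖² - w) - (w - v) + w                 ≡⟨ collect ‖ Y ‖² w v ⟩
        (‖ Y ‖² - w) + v                           ≤⟨ +-monoʳ-≤ (‖ Y ‖² - w) v≤w ⟩
        (‖ Y ‖² - w) + w                           ≡⟨ cancel ‖ Y ‖² w ⟩
        ‖ Y ‖²                                     ∎
        where
        open ≤-Reasoning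
        MMᵀY = M ⊗ (M ᵀ ⊗ Y)
        w = ‖ M ᵀ ⊗ Y ‖²
        v = ‖ MMᵀY ‖²
        collect : ∀ a b c → (a - b) - (b - c) + b ≡ (a - b) + c
        collect = solve-∀ ring
        cancel : ∀ a b → (a - b) + b ≡ a
        cancel = solve-∀ ring
        cross : ⟨ MMᵀY , Y ⟩ ≡ w
        cross = ⊗-adjoint M (M ᵀ ⊗ Y) Y
        expand : ‖ step Y ‖² ≡ (‖ Y ‖² - w) - (w - v)
        expand = trans (⟨⟩-⊖ˡ Y MMᵀY (step Y)) (cong₂ _-_
          (trans (⟨⟩-⊖ʳ Y Y MMᵀY) (cong (λ x → ‖ Y ‖² - x) (trans (⟨⟩-comm Y MMᵀY) cross)))
          (trans (⟨⟩-⊖ʳ MMᵀY Y MMᵀY) (cong (λ x → x - v) cross)))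
        v≤w : v ≤ w
        v≤w = begin
          v            ≤⟨ ‖⊗‖² M (M ᵀ ⊗ Y) ⟩
          ‖ M ‖² * w   ≤⟨ *-monoʳ (‖‖²-nonneg (M ᵀ ⊗ Y)) ‖M‖²≤1 ⟩
          1ℚ * w       ≡⟨ *-identityˡ w ⟩
          w            ∎

      ‖step‖²≤ : ∀ Y → ‖ step Y ‖² ≤ ‖ Y ‖²
      ‖step‖²≤ Y = ≤-trans (≤-of-≡+ (‖‖²-nonneg (M ᵀ ⊗ Y)) refl) (‖step‖² Y)

      ‖iter‖²≤ : ∀ r Y → ‖ iter r Y ‖² ≤ ‖ Y ‖²
      ‖iter‖²≤ zero    Y = ≤-refl
      ‖iter‖²≤ (suc r) Y = ≤-trans (‖step‖²≤ (iter r Y)) (‖iter‖²≤ r Y)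

      -- Bounded rank is encoded by a right unit `E` for M of bounded norm. Of the margin t + t by
      -- which the trace is negative, one t pays for the drift over `R` steps and the other
      -- survives.
      module _ (E : Mat) (ME≐M : M ⊗ E ≐ M) (η : ℚ) (‖E‖²≤η : ‖ E ᵀ ‖² ≤ η)
               (δ : ℚ) (0≤δ : 0ℚ ≤ δ) (‖MM‖²≤δ² : ‖ M ⊗ M ‖² ≤ δ * δ)
               (R : ℕ) (t : ℚ) (Rδ≤t : ι R * δ ≤ t) (tr≤ : tr M + (t + t) ≤ 0ℚ) where

        -- Plays the part of (tr Y)² ≤ rank(Y) · ‖Y‖²: the trace of Y = YE is the inner product of
        -- `Y` with Eᵀ.
        tr-square-≤ : ∀ Y → Y ⊗ E ≐ Y → tr Y * tr Y ≤ η * ‖ Y ‖²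
        tr-square-≤ Y YE≐Y = begin
          tr Y * tr Y                    ≡⟨ cong₂ _*_ (sym (tr-cong YE≐Y)) (sym (tr-cong YE≐Y)) ⟩
          tr (Y ⊗ E) * tr (Y ⊗ E)        ≤⟨ cauchy-schwarz Y (E ᵀ) ⟩
          ‖ Y ‖² * ‖ E ᵀ ‖²              ≤⟨ *-monoˡ (‖‖²-nonneg Y) ‖E‖²≤η ⟩
          ‖ Y ‖² * η                     ≡⟨ *-comm ‖ Y ‖² η ⟩
          η * ‖ Y ‖²                     ∎
          where open ≤-Reasoning

        y : ℕ → Mat
        y r = iter r M

        y⊗E : ∀ r → y r ⊗ E ≐ y r
        y⊗E r = ≐-trans (iter-⊗ r M E) (iter-cong r ME≐M)

        -- The change is tr (M Mᵀ y) = ⟨ M , y M ⟩, where y M = iter r (M ⊗ M) is small.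
        tr-step : ∀ r → tr (y (suc r)) ≤ tr (y r) + δ
        tr-step r = begin
          tr (y (suc r))                          ≡⟨ sum-- (λ i → y r i i) (λ i → (M ⊗ (M ᵀ ⊗ y r)) i i) ⟩
          tr (y r) - tr (M ⊗ (M ᵀ ⊗ y r))         ≤⟨ +-monoʳ-≤ (tr (y r)) bound ⟩
          tr (y r) + δ                            ∎
          where
          open ≤-Reasoning
          x = ⟨ M , y r ⊗ M ⟩
          ‖yM‖²≤ : ‖ y r ⊗ M ‖² ≤ δ * δ
          ‖yM‖²≤ = begin
            ‖ y r ⊗ M ‖²          ≡⟨ ⟨⟩-cong (iter-⊗ r M M) (iter-⊗ r M M) ⟩
            ‖ iter r (M ⊗ M) ‖²   ≤⟨ ‖iter‖²≤ r (M ⊗ M) ⟩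
            ‖ M ⊗ M ‖²            ≤⟨ ‖MM‖²≤δ² ⟩
            δ * δ                 ∎
          bound : - tr (M ⊗ (M ᵀ ⊗ y r)) ≤ δ
          bound = square-cancel-≤ 0≤δ (begin
            - tr (M ⊗ (M ᵀ ⊗ y r)) * - tr (M ⊗ (M ᵀ ⊗ y r))
              ≡⟨ neg-square (tr (M ⊗ (M ᵀ ⊗ y r))) ⟩
            tr (M ⊗ (M ᵀ ⊗ y r)) * tr (M ⊗ (M ᵀ ⊗ y r))
              ≡⟨ cong₂ _*_ (tr-⊗-⊗ᵀ M M (y r)) (tr-⊗-⊗ᵀ M M (y r)) ⟩
            x * x                    ≤⟨ cauchy-schwarz M (y r ⊗ M) ⟩
            ‖ M ‖² * ‖ y r ⊗ M ‖²    ≤⟨ *-mono (‖‖²-nonneg M) ‖M‖²≤1 (‖‖²-nonneg (y r ⊗ M)) ‖yM‖²≤ ⟩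
            1ℚ * (δ * δ)             ≡⟨ *-identityˡ (δ * δ) ⟩
            δ * δ                    ∎)

        tr-y : ∀ r → tr (y r) ≤ tr M + ι r * δ
        tr-y zero = ≤-reflexive (sym (trans (cong (tr M +_) (*-zeroˡ δ)) (+-identityʳ (tr M))))
        tr-y (suc r) = begin
          tr (y (suc r))            ≤⟨ tr-step r ⟩
          tr (y r) + δ              ≤⟨ +-monoˡ-≤ δ (tr-y r) ⟩
          tr M + ι r * δ + δ        ≡⟨ collect (tr M) (ι r) δ ⟩
          tr M + (1ℚ + ι r) * δ     ∎
          where
          open ≤-Reasoning
          collect : ∀ a b c → a + b * c + c ≡ a + (1ℚ + b) * c
          collect = solve-∀ ring

        t≤-tr-y : ∀ {r} → r ℕ.≤ R → t ≤ - tr (y r)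
        t≤-tr-y {r} r≤R = begin
          t                                     ≡⟨ shift t (tr M) ⟩
          - (tr M) - t + (tr M + (t + t))       ≤⟨ +-monoʳ-≤ (- (tr M) - t) tr≤ ⟩
          - (tr M) - t + 0ℚ                     ≡⟨ regroup (tr M) t ⟩
          - (tr M + t)                          ≤⟨ neg-antimono-≤ (+-monoʳ-≤ (tr M) rδ≤t) ⟩
          - (tr M + ι r * δ)                    ≤⟨ neg-antimono-≤ (tr-y r) ⟩
          - tr (y r)                            ∎
          where
          open ≤-Reasoning
          rδ≤t : ι r * δ ≤ t
          rδ≤t = ≤-trans (*-monoʳ 0≤δ (ι-mono r≤R)) Rδ≤t
          shift : ∀ a b → a ≡ - b - a + (b + (a + a))
          shift = solve-∀ ring
          regroup : ∀ a b → - a - b + 0ℚ ≡ - (a + b)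
          regroup = solve-∀ ring

        -- step is self-adjoint.
        ‖y‖²≡ : ∀ r → ‖ y r ‖² ≡ tr ((M ᵀ) ⊗ y (r ℕ.+ r))
        ‖y‖²≡ r = begin
          ⟨ y r , y r ⟩          ≡⟨ ⟨iter,⟩ r M (y r) ⟩
          ⟨ M , iter r (y r) ⟩   ≡⟨ cong ⟨ M ,_⟩ (sym (iter-+ r r M)) ⟩
          ⟨ M , y (r ℕ.+ r) ⟩    ≡⟨ ∑-comm (λ i j → M i j * y (r ℕ.+ r) i j) ⟩
          tr ((M ᵀ) ⊗ y (r ℕ.+ r)) ∎
          where open ≡-Reasoning

        η³ t⁴ : ℚ
        η³ = η * η * η
        t⁴ = (t * t) * (t * t)

        0≤η : 0ℚ ≤ η
        0≤η = ≤-trans (‖‖²-nonneg (E ᵀ)) ‖E‖²≤η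

        -- `tr-square-≤` is applied twice. For `y r` it gives t² ≤ η ‖y r‖²; for `W`, whose trace is
        -- ‖y r‖² by self-adjointness, it bounds the square of that.
        t⁴≤ : 0ℚ ≤ t → ∀ {r} → r ℕ.≤ R → t⁴ ≤ η³ * ‖ M ᵀ ⊗ y (r ℕ.+ r) ‖²
        t⁴≤ 0≤t {r} r≤R = begin
          (t * t) * (t * t)            ≤⟨ square-mono (0≤square t) t²≤ ⟩
          (η * ‖ y r ‖²) * (η * ‖ y r ‖²) ≡⟨ square-* η ‖ y r ‖² ⟩
          (η * η) * (‖ y r ‖² * ‖ y r ‖²) ≡⟨ cong (λ x → (η * η) * (x * x)) (‖y‖²≡ r) ⟩
          (η * η) * (tr W * tr W)      ≤⟨ *-monoˡ (0≤square η) (tr-square-≤ W W⊗E) ⟩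
          (η * η) * (η * ‖ W ‖²)       ≡⟨ sym (*-assoc (η * η) η ‖ W ‖²) ⟩
          η³ * ‖ W ‖²                  ∎
          where
          open ≤-Reasoning
          W = M ᵀ ⊗ y (r ℕ.+ r)
          W⊗E : W ⊗ E ≐ W
          W⊗E = ≐-trans (⊗-assoc (M ᵀ) (y (r ℕ.+ r)) E)
            (⊗-cong {A = M ᵀ} (λ _ _ → refl) (y⊗E (r ℕ.+ r)))
          t²≤ : t * t ≤ η * ‖ y r ‖²
          t²≤ = begin
            t * t                      ≤⟨ square-mono 0≤t (t≤-tr-y r≤R) ⟩
            - tr (y r) * - tr (y r)    ≡⟨ neg-square (tr (y r)) ⟩
            tr (y r) * tr (y r)        ≤⟨ tr-square-≤ (y r) (y⊗E r) ⟩
            η * ‖ y r ‖²               ∎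

        -- One unit of `r` is two steps, since `t⁴≤` speaks of the index r + r. Only the first of
        -- the two is charged with a loss of t⁴ / η³; the second merely does not increase the norm.
        decrease : 0ℚ ≤ t → ∀ r → r ℕ.≤ R → η³ * ‖ y (r ℕ.+ r) ‖² + ι r * t⁴ ≤ η³
        decrease 0≤t zero _ = begin
          η³ * ‖ M ‖² + 0ℚ * t⁴   ≡⟨ drop (η³ * ‖ M ‖²) t⁴ ⟩
          η³ * ‖ M ‖²             ≤⟨ *-monoˡ (*-nonneg (0≤square η) 0≤η) ‖M‖²≤1 ⟩
          η³ * 1ℚ                 ≡⟨ *-identityʳ η³ ⟩
          η³                      ∎
          where
          open ≤-Reasoning
          drop : ∀ a b → a + 0ℚ * b ≡ a
          drop = solve-∀ ring
        decrease 0≤t (suc r) r<R = begin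
          η³ * ‖ y (suc (r ℕ.+ suc r)) ‖² + (1ℚ + ι r) * t⁴
            ≡⟨ cong (λ m → η³ * ‖ y (suc m) ‖² + (1ℚ + ι r) * t⁴) (ℕₚ.+-suc r r) ⟩
          η³ * ‖ step (step Y) ‖² + (1ℚ + ι r) * t⁴
            ≡⟨ expand (η³ * ‖ step (step Y) ‖²) (ι r) t⁴ ⟩
          η³ * ‖ step (step Y) ‖² + t⁴ + ι r * t⁴
            ≤⟨ +-monoˡ-≤ (ι r * t⁴) (+-mono-≤ (*-monoˡ 0≤η³ (‖step‖²≤ (step Y))) (t⁴≤ 0≤t r≤R)) ⟩
          η³ * ‖ step Y ‖² + η³ * ‖ M ᵀ ⊗ Y ‖² + ι r * t⁴
            ≡⟨ cong (_+ ι r * t⁴) (sym (*-distribˡ-+ η³ ‖ step Y ‖² ‖ M ᵀ ⊗ Y ‖²)) ⟩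
          η³ * (‖ step Y ‖² + ‖ M ᵀ ⊗ Y ‖²) + ι r * t⁴
            ≤⟨ +-monoˡ-≤ (ι r * t⁴) (*-monoˡ 0≤η³ (‖step‖² Y)) ⟩
          η³ * ‖ Y ‖² + ι r * t⁴
            ≤⟨ decrease 0≤t r r≤R ⟩
          η³ ∎
          where
          open ≤-Reasoning
          Y = y (r ℕ.+ r)
          r≤R = ℕₚ.<⇒≤ r<R
          0≤η³ = *-nonneg (0≤square η) 0≤η
          expand : ∀ a b c → a + (1ℚ + b) * c ≡ a + c + b * c
          expand = solve-∀ ring

        nearly-nilpotent⇒small-trace : 0ℚ ≤ t → ι R * t⁴ ≤ η³
        nearly-nilpotent⇒small-trace 0≤t = ≤-trans
          (≤-of-≡+ (*-nonneg (*-nonneg (0≤square η) 0≤η) (‖‖²-nonneg (y (R ℕ.+ R)))) (+-comm _ (ι R * t⁴)))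
          (decrease 0≤t R ℕₚ.≤-refl)

  halve : ∀ {x y} → x + x ≤ y + y → x ≤ y
  halve {x} {y} 2x≤2y with x ≤? y
  ... | yes x≤y = x≤y
  ... | no  x≰y = contradiction 2x≤2y (<⇒≱ (+-mono-< (≰⇒> x≰y) (≰⇒> x≰y)))

  -- Indicator functions and counting along injective maps.

  𝟙 : Bool → ℚ
  𝟙 true  = 1ℚ
  𝟙 false = 0ℚ

  0≤𝟙 : ∀ x → 0ℚ ≤ 𝟙 x
  0≤𝟙 true  = 0≤1
  0≤𝟙 false = ≤-refl

  𝟙≤1 : ∀ x → 𝟙 x ≤ 1ℚ
  𝟙≤1 true  = ≤-refl
  𝟙≤1 false = 0≤1

  𝟙-idem : ∀ x → 𝟙 x * 𝟙 x ≡ 𝟙 x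
  𝟙-idem true  = refl
  𝟙-idem false = refl

  sum-lookup : ∀ {n} (A : Subset n) → sum (λ x → 𝟙 (lookup A x)) ≡ ι ∣ A ∣
  sum-lookup []          = refl
  sum-lookup (true ∷ A)  = cong (1ℚ +_) (sum-lookup A)
  sum-lookup (false ∷ A) = trans (+-identityˡ _) (sum-lookup A)

  δ : ∀ {n} → Fin n → Fin n → ℚ
  δ x y = 𝟙 (does (x ≟ᶠ y))

  δ-refl : ∀ {n} (x : Fin n) → δ x x ≡ 1ℚ
  δ-refl x with x ≟ᶠ x
  ... | yes _   = refl
  ... | no  x≢x = contradiction refl x≢x

  sum-δ : ∀ {n} (w : Fin n) (c : Fin n → ℚ) → sum (λ x → δ w x * c x) ≡ c w
  sum-δ zero c = trans
    (cong₂ _+_ (*-identityˡ (c zero)) (sum-0 λ x → *-zeroˡ (c (suc x)))) (+-identityʳ (c zero))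
  sum-δ (suc w) c = trans (cong (_+ sum (λ x → δ w x * c (suc x))) (*-zeroˡ (c zero)))
    (trans (+-identityˡ _) (sum-δ w (c ∘ suc)))

  -- `P` contains the support of `f` and holds at one index at most, so `f` is dominated by the
  -- delta function there.
  sum-≤1 : ∀ {s} (f : Fin s → ℚ) {P : Fin s → Set} → (∀ i → Dec (P i)) →
    (∀ i → ¬ P i → f i ≡ 0ℚ) → (∀ i → f i ≤ 1ℚ) → (∀ i j → P i → P j → i ≡ j) → sum f ≤ 1ℚ
  sum-≤1 f P? f≡0 f≤1 unique with any? P?
  ... | no  none       = ≤-trans (≤-reflexive (sum-0 λ i → f≡0 i λ Pi → none (i , Pi))) 0≤1
  ... | yes (i₀ , Pi₀) = ≤-trans (sum-mono bound) (≤-reflexive (sum-δ i₀ (λ _ → 1ℚ)))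
    where
    bound : ∀ i → f i ≤ δ i₀ i * 1ℚ
    bound i with P? i
    ... | yes Pi with refl ← unique i₀ i Pi₀ Pi = subst (λ x → f i ≤ x * 1ℚ) (sym (δ-refl i)) (f≤1 i)
    ... | no ¬Pi = ≤-trans (≤-reflexive (f≡0 i ¬Pi)) (*-nonneg (0≤𝟙 (does (i₀ ≟ᶠ i))) 0≤1)

  -- Inserting `δ (φ i j) x` and exchanging sums groups the pairs by their value x; each fibre holds
  -- at most one pair.
  sum-injective-≤ : ∀ {s n} (φ : Fin s → Fin s → Fin n) →
    (∀ i j i′ j′ → φ i j ≡ φ i′ j′ → i ≡ i′ × j ≡ j′) →
    (c : Fin n → ℚ) → (∀ x → 0ℚ ≤ c x) → sum (λ i → sum λ j → c (φ i j)) ≤ sum c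
  sum-injective-≤ φ φ-inj c 0≤c = begin
    sum (λ i → sum λ j → c (φ i j))
      ≡⟨ sum-cong-≗ (λ i → sum-cong-≗ λ j → sym (sum-δ (φ i j) c)) ⟩
    sum (λ i → sum λ j → sum λ x → δ (φ i j) x * c x)
      ≡⟨ sum-cong-≗ (λ i → ∑-comm (λ j x → δ (φ i j) x * c x)) ⟩
    sum (λ i → sum λ x → sum λ j → δ (φ i j) x * c x)
      ≡⟨ ∑-comm (λ i x → sum λ j → δ (φ i j) x * c x) ⟩
    sum (λ x → sum λ i → sum λ j → δ (φ i j) x * c x)
      ≡⟨ sum-cong-≗ (λ x → sum-cong-≗ λ i → sym (*-distribʳ-sum (c x) (λ j → δ (φ i j) x))) ⟩
    sum (λ x → sum λ i → fibre x i * c x)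
      ≡⟨ sum-cong-≗ (λ x → sym (*-distribʳ-sum (c x) (fibre x))) ⟩
    sum (λ x → sum (fibre x) * c x)
      ≤⟨ sum-mono (λ x → *-monoʳ (0≤c x) (fibres≤1 x)) ⟩
    sum (λ x → 1ℚ * c x)
      ≡⟨ sum-cong-≗ (λ x → *-identityˡ (c x)) ⟩
    sum c ∎
    where
    open ≤-Reasoning
    fibre : Fin _ → Fin _ → ℚ
    fibre x i = sum λ j → δ (φ i j) x
    δ≡0 : ∀ {i j x} → φ i j ≢ x → δ (φ i j) x ≡ 0ℚ
    δ≡0 {i} {j} {x} φ≢x with φ i j ≟ᶠ x
    ... | yes φ≡x = contradiction φ≡x φ≢x
    ... | no  _   = refl
    fibre≤1 : ∀ x i → fibre x i ≤ 1ℚ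
    fibre≤1 x i = sum-≤1 (λ j → δ (φ i j) x) (λ j → φ i j ≟ᶠ x) (λ j → δ≡0)
      (λ j → 𝟙≤1 (does (φ i j ≟ᶠ x))) λ j j′ p q → proj₂ (φ-inj i j i j′ (trans p (sym q)))
    fibres≤1 : ∀ x → sum (fibre x) ≤ 1ℚ
    fibres≤1 x = sum-≤1 (fibre x) (λ i → any? λ j → φ i j ≟ᶠ x)
      (λ i none → sum-0 λ j → δ≡0 λ p → none (j , p)) (fibre≤1 x)
      λ { i i′ (j , p) (j′ , q) → proj₁ (φ-inj i j i′ j′ (trans p (sym q))) }

  -- Counting in cosets of H

  module SidonCounting {n : ℕ} (G : FinGroup n) (H : Subset n) (HN : IsNormalAbelianSubgroup G H)
    {s : ℕ} (b : Fin s → Fin n)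
    (b-S₂ : ∀ i j i′ j′ → FinGroup._∙_ G (b i) (b j) ≡ FinGroup._∙_ G (b i′) (b j′) → i ≡ i′ × j ≡ j′)
    where

    open FinGroup G
    group : Group _ _
    group = record { isGroup = isGroup }
    open Group group using (assoc; identityʳ)
    open GroupProperties group
      using (⁻¹-involutive; ⁻¹-anti-homo-∙; \\-leftDividesˡ; \\-leftDividesʳ; //-rightDividesˡ; //-rightDividesʳ; ⁻¹-anti-homo-\\)

    ∙-closed : ∀ {x y} → x ∈ H → y ∈ H → x ∙ y ∈ H
    ∙-closed = proj₁ (proj₂ HN) _ _
    inv-closed : ∀ {x} → x ∈ H → inv x ∈ H
    inv-closed = proj₁ (proj₂ (proj₂ HN)) _
    conj-closed : ∀ g {x} → x ∈ H → (g ∙ x) ∙ inv g ∈ H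
    conj-closed g = proj₁ (proj₂ (proj₂ (proj₂ HN))) g _
    H-comm : ∀ {x y} → x ∈ H → y ∈ H → x ∙ y ≡ y ∙ x
    H-comm = proj₂ (proj₂ (proj₂ (proj₂ HN))) _ _

    χ : Fin n → ℚ
    χ x = 𝟙 (lookup H x)

    0≤χ : ∀ x → 0ℚ ≤ χ x
    0≤χ x = 0≤𝟙 (lookup H x)

    χ-∈ : ∀ {x} → x ∈ H → χ x ≡ 1ℚ
    χ-∈ x∈H = cong 𝟙 ([]=⇒lookup x∈H)

    χ-∉ : ∀ {x} → ¬ x ∈ H → χ x ≡ 0ℚ
    χ-∉ {x} x∉H = cong 𝟙 (¬-not λ eq → x∉H (lookup⇒[]= x H eq))

    χ-⇔ : ∀ {x y} → (x ∈ H → y ∈ H) → (y ∈ H → x ∈ H) → χ x ≡ χ y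
    χ-⇔ {x} {y} f g with x ∈? H
    ... | yes x∈H = trans (χ-∈ x∈H) (sym (χ-∈ (f x∈H)))
    ... | no  x∉H = trans (χ-∉ x∉H) (sym (χ-∉ (λ y∈H → x∉H (g y∈H))))

    -- Allows one coset representative to replace another under the indicator that both lie in the
    -- same coset.
    χ-guard : ∀ {v a c} → (v ∈ H → a ≡ c) → χ v * a ≡ χ v * c
    χ-guard {v} {a} {c} eq with v ∈? H
    ... | yes v∈H = cong (χ v *_) (eq v∈H)
    ... | no  v∉H = trans (zero-left a) (sym (zero-left c))
      where
      zero-left : ∀ x → χ v * x ≡ 0ℚ
      zero-left x = trans (cong (_* x) (χ-∉ v∉H)) (*-zeroˡ x)

    χ-∙ʳ : ∀ x {u} → u ∈ H → χ (x ∙ u) ≡ χ x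
    χ-∙ʳ x {u} u∈H = χ-⇔
      (λ xu∈H → subst (_∈ H) (//-rightDividesʳ u x) (∙-closed xu∈H (inv-closed u∈H)))
      (λ x∈H → ∙-closed x∈H u∈H)

    χ-∙ˡ : ∀ x {u} → u ∈ H → χ (u ∙ x) ≡ χ x
    χ-∙ˡ x {u} u∈H = χ-⇔
      (λ ux∈H → subst (_∈ H) (\\-leftDividesʳ u x) (∙-closed (inv-closed u∈H) ux∈H))
      (λ x∈H → ∙-closed u∈H x∈H)

    -- When yH = zH, the representative y may be replaced by z: y⁻¹w = (y⁻¹z)(z⁻¹w), and the first
    -- factor lies in `H`.
    χ-inverses : ∀ y z w → χ (inv y ∙ z) * χ (inv y ∙ w) ≡ χ (inv y ∙ z) * χ (inv z ∙ w)
    χ-inverses y z w = χ-guard λ v∈H → trans (cong χ (sym eq)) (χ-∙ˡ (inv z ∙ w) v∈H)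
      where
      eq : (inv y ∙ z) ∙ (inv z ∙ w) ≡ inv y ∙ w
      eq = trans (assoc (inv y) z _) (cong (inv y ∙_) (\\-leftDividesˡ z w))

    -- Here normality enters: with v = y⁻¹w in `H`, one has wc = (yc)(c⁻¹vc), so right translation
    -- by c respects cosets.
    χ-shift : ∀ y z w c → χ (inv y ∙ w) * χ (inv z ∙ (y ∙ c)) ≡ χ (inv y ∙ w) * χ (inv z ∙ (w ∙ c))
    χ-shift y z w c = χ-guard λ v∈H →
      sym (trans (cong χ (eq (inv y ∙ w) refl))
                 (χ-∙ʳ (inv z ∙ (y ∙ c)) (subst (λ x → (inv c ∙ (inv y ∙ w)) ∙ x ∈ H) (⁻¹-involutive c)
                                                (conj-closed (inv c) v∈H))))
      where
      open ≡-Reasoning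
      eq : ∀ v → v ≡ inv y ∙ w → inv z ∙ (w ∙ c) ≡ (inv z ∙ (y ∙ c)) ∙ ((inv c ∙ v) ∙ c)
      eq v refl = sym (begin
        (inv z ∙ (y ∙ c)) ∙ ((inv c ∙ v) ∙ c)  ≡⟨ assoc (inv z) (y ∙ c) _ ⟩
        inv z ∙ ((y ∙ c) ∙ ((inv c ∙ v) ∙ c))  ≡⟨ cong (inv z ∙_) (begin
          (y ∙ c) ∙ ((inv c ∙ v) ∙ c)   ≡⟨ assoc y c _ ⟩
          y ∙ (c ∙ ((inv c ∙ v) ∙ c))   ≡⟨ cong (λ x → y ∙ (c ∙ x)) (assoc (inv c) v c) ⟩
          y ∙ (c ∙ (inv c ∙ (v ∙ c)))   ≡⟨ cong (y ∙_) (\\-leftDividesˡ c (v ∙ c)) ⟩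
          y ∙ ((inv y ∙ w) ∙ c)         ≡⟨ cong (y ∙_) (assoc (inv y) w c) ⟩
          y ∙ (inv y ∙ (w ∙ c))         ≡⟨ \\-leftDividesˡ y (w ∙ c) ⟩
          w ∙ c                         ∎) ⟩
        inv z ∙ (w ∙ c)                        ∎)

    q : ℚ
    q = ι ∣ H ∣

    sum-χ : sum χ ≡ q
    sum-χ = sum-lookup H

    sum-χ-∙ : ∀ a c → sum (λ g → χ (a ∙ (g ∙ c))) ≡ q
    sum-χ-∙ a c = trans (sym (sum-permute χ (permutation to from to-from from-to))) sum-χ
      where
      to from : Fin n → Fin n
      to   g = a ∙ (g ∙ c)
      from x = (inv a ∙ x) ∙ inv c
      to-from : ∀ x → to (from x) ≡ x
      to-from x = trans (cong (a ∙_) (//-rightDividesˡ c (inv a ∙ x))) (\\-leftDividesˡ a x)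
      from-to : ∀ x → from (to x) ≡ x
      from-to x = trans (cong (_∙ inv c) (\\-leftDividesʳ a (x ∙ c))) (//-rightDividesʳ c x)

    sum-χ-∙ˡ : ∀ a → sum (λ g → χ (a ∙ g)) ≡ q
    sum-χ-∙ˡ a = trans (sum-cong-≗ λ g → cong (λ x → χ (a ∙ x)) (sym (identityʳ g))) (sum-χ-∙ a e)

    sum-χ-inv : ∀ w → sum (λ y → χ (inv y ∙ w)) ≡ q
    sum-χ-inv w = trans (sym (sum-permute χ (permutation to from to-from from-to))) sum-χ
      where
      to from : Fin n → Fin n
      to   y = inv y ∙ w
      from x = w ∙ inv x
      to-from : ∀ x → to (from x) ≡ x
      to-from x = begin
        inv (w ∙ inv x) ∙ w            ≡⟨ cong (_∙ w) (⁻¹-anti-homo-∙ w (inv x)) ⟩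
        (inv (inv x) ∙ inv w) ∙ w      ≡⟨ //-rightDividesˡ w (inv (inv x)) ⟩
        inv (inv x)                    ≡⟨ ⁻¹-involutive x ⟩
        x                              ∎
        where open ≡-Reasoning
      from-to : ∀ x → from (to x) ≡ x
      from-to x = trans (cong (w ∙_) (⁻¹-anti-homo-\\ x w)) (\\-leftDividesˡ w x)

    -- The entries depend only on the cosets of g and y or z. Using Γ itself as index set avoids
    -- building the quotient, at the price of a factor `q` in matrix products. `F` counts the i with
    -- g bᵢ ∈ yH, `P` the pairs with g bᵢ bⱼ ∈ zH.
    E F P : Mat
    E g y = χ (inv g ∙ y)
    F g y = sum λ i → χ (inv y ∙ (g ∙ b i))
    P g z = sum λ i → sum λ j → χ (inv z ∙ ((g ∙ b i) ∙ b j))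

    F-nonneg : ∀ g y → 0ℚ ≤ F g y
    F-nonneg g y = sum-nonneg λ i → 0≤χ (inv y ∙ (g ∙ b i))

    F≤s : ∀ g y → F g y ≤ ι s
    F≤s g y = ≤-trans (sum-mono λ i → 𝟙≤1 (lookup H (inv y ∙ (g ∙ b i))))
      (≤-reflexive (trans (sum-const s 1ℚ) (*-identityʳ (ι s))))

    -- This is where `H` being abelian enters: for bᵢ and bⱼ in `H`, bᵢbⱼ = bⱼbᵢ, so the S₂ property
    -- forces i = j.
    F-diagonal : ∀ g → F g g ≤ 1ℚ
    F-diagonal g = begin
      F g g                ≡⟨ sum-cong-≗ (λ i → cong χ (\\-leftDividesʳ g (b i))) ⟩
      sum (λ i → χ (b i))  ≤⟨ sum-≤1 (λ i → χ (b i)) (λ i → b i ∈? H) (λ i → χ-∉) (λ i → 𝟙≤1 (lookup H (b i)))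
                                (λ i j bi∈H bj∈H → proj₁ (b-S₂ i j j i (H-comm bi∈H bj∈H))) ⟩
      1ℚ                   ∎
      where open ≤-Reasoning

    F-row : ∀ g → sum (λ y → F g y) ≡ ι s * q
    F-row g = begin
      sum (λ y → sum λ i → χ (inv y ∙ (g ∙ b i)))  ≡⟨ ∑-comm (λ y i → χ (inv y ∙ (g ∙ b i))) ⟩
      sum (λ i → sum λ y → χ (inv y ∙ (g ∙ b i)))  ≡⟨ sum-cong-≗ (λ i → sum-χ-inv (g ∙ b i)) ⟩
      sum (λ (i : Fin s) → q)                      ≡⟨ sum-const s q ⟩
      ι s * q                                      ∎
      where open ≡-Reasoning

    F-column : ∀ y → sum (λ g → F g y) ≡ ι s * q
    F-column y = begin
      sum (λ g → sum λ i → χ (inv y ∙ (g ∙ b i)))  ≡⟨ ∑-comm (λ g i → χ (inv y ∙ (g ∙ b i))) ⟩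
      sum (λ i → sum λ g → χ (inv y ∙ (g ∙ b i)))  ≡⟨ sum-cong-≗ (λ i → sum-χ-∙ (inv y) (b i)) ⟩
      sum (λ (i : Fin s) → q)                      ≡⟨ sum-const s q ⟩
      ι s * q                                      ∎
      where open ≡-Reasoning

    F⊗E : ∀ g z → (F ⊗ E) g z ≡ q * F g z
    F⊗E g z = begin
      sum (λ y → sum (λ i → χ (inv y ∙ (g ∙ b i))) * χ (inv y ∙ z))
        ≡⟨ sum-cong-≗ (λ y → *-distribʳ-sum (χ (inv y ∙ z)) (λ i → χ (inv y ∙ (g ∙ b i)))) ⟩
      sum (λ y → sum λ i → χ (inv y ∙ (g ∙ b i)) * χ (inv y ∙ z))
        ≡⟨ ∑-comm (λ y i → χ (inv y ∙ (g ∙ b i)) * χ (inv y ∙ z)) ⟩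
      sum (λ i → sum λ y → χ (inv y ∙ (g ∙ b i)) * χ (inv y ∙ z))
        ≡⟨ sum-cong-≗ (λ i → sum-cong-≗ λ y →
             trans (*-comm _ (χ (inv y ∙ z))) (χ-inverses y z (g ∙ b i))) ⟩
      sum (λ i → sum λ y → χ (inv y ∙ z) * χ (inv z ∙ (g ∙ b i)))
        ≡⟨ sum-cong-≗ (λ i → sym (*-distribʳ-sum (χ (inv z ∙ (g ∙ b i))) (λ y → χ (inv y ∙ z)))) ⟩
      sum (λ i → sum (λ y → χ (inv y ∙ z)) * χ (inv z ∙ (g ∙ b i)))
        ≡⟨ sym (*-distribˡ-sum (sum λ y → χ (inv y ∙ z)) (λ i → χ (inv z ∙ (g ∙ b i)))) ⟩
      sum (λ y → χ (inv y ∙ z)) * F g z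
        ≡⟨ cong (_* F g z) (sum-χ-inv z) ⟩
      q * F g z ∎
      where open ≡-Reasoning

    -- For each i, the y that contribute are the `q` elements of the coset g bᵢ H, and by `χ-shift`
    -- each of them may be replaced by g bᵢ.
    F⊗F : ∀ g z → (F ⊗ F) g z ≡ q * P g z
    F⊗F g z = begin
      sum (λ y → sum (λ i → u y i) * sum (λ j → v y j))
        ≡⟨ sum-cong-≗ (λ y → *-distribʳ-sum (sum (v y)) (u y)) ⟩
      sum (λ y → sum λ i → u y i * sum (λ j → v y j))
        ≡⟨ sum-cong-≗ (λ y → sum-cong-≗ λ i → *-distribˡ-sum (u y i) (v y)) ⟩
      sum (λ y → sum λ i → sum λ j → u y i * v y j)
        ≡⟨ sum-cong-≗ (λ y → sum-cong-≗ λ i → sum-cong-≗ λ j → χ-shift y z (g ∙ b i) (b j)) ⟩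
      sum (λ y → sum λ i → sum λ j → u y i * p i j)
        ≡⟨ sum-cong-≗ (λ y → sum-cong-≗ λ i → sym (*-distribˡ-sum (u y i) (p i))) ⟩
      sum (λ y → sum λ i → u y i * sum (p i))
        ≡⟨ ∑-comm (λ y i → u y i * sum (p i)) ⟩
      sum (λ i → sum λ y → u y i * sum (p i))
        ≡⟨ sum-cong-≗ (λ i → sym (*-distribʳ-sum (sum (p i)) (λ y → u y i))) ⟩
      sum (λ i → sum (λ y → u y i) * sum (p i))
        ≡⟨ sum-cong-≗ (λ i → cong (_* sum (p i)) (sum-χ-inv (g ∙ b i))) ⟩
      sum (λ i → q * sum (p i))
        ≡⟨ sym (*-distribˡ-sum q (λ i → sum (p i))) ⟩
      q * P g z ∎
      where
      open ≡-Reasoning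
      u v : Fin n → Fin s → ℚ
      u y i = χ (inv y ∙ (g ∙ b i))
      v y j = χ (inv z ∙ (y ∙ b j))
      p : Fin s → Fin s → ℚ
      p i j = χ (inv z ∙ ((g ∙ b i) ∙ b j))

    P-nonneg : ∀ g z → 0ℚ ≤ P g z
    P-nonneg g z = sum-nonneg λ i → sum-nonneg λ j → 0≤χ (inv z ∙ ((g ∙ b i) ∙ b j))

    -- The products bᵢbⱼ are distinct, so at most |H| of them fall into the coset g⁻¹zH. No coset
    -- can be overfull, which is what forces equidistribution once s² is near n.
    P≤q : ∀ g z → P g z ≤ q
    P≤q g z = begin
      P g z
        ≡⟨ sum-cong-≗ (λ i → sum-cong-≗ λ j → cong χ (trans (cong (inv z ∙_) (assoc g (b i) (b j))) (sym (assoc (inv z) g _)))) ⟩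
      sum (λ i → sum λ j → χ ((inv z ∙ g) ∙ (b i ∙ b j)))
        ≤⟨ sum-injective-≤ (λ i j → b i ∙ b j) b-S₂ (λ x → χ ((inv z ∙ g) ∙ x)) (λ x → 0≤χ _) ⟩
      sum (λ x → χ ((inv z ∙ g) ∙ x))
        ≡⟨ sum-χ-∙ˡ (inv z ∙ g) ⟩
      q ∎
      where open ≤-Reasoning

    P-row : ∀ g → sum (λ z → P g z) ≡ ι s * (ι s * q)
    P-row g = begin
      sum (λ z → sum λ i → sum λ j → p i j z)  ≡⟨ sum-swap₁₃ (λ z i j → p i j z) ⟩
      sum (λ j → sum λ i → sum λ z → p i j z)
        ≡⟨ sum-cong-≗ (λ j → sum-cong-≗ λ i → sum-χ-inv ((g ∙ b i) ∙ b j)) ⟩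
      sum (λ (j : Fin s) → sum λ (i : Fin s) → q)   ≡⟨ sum-cong-≗ {s} (λ j → sum-const s q) ⟩
      sum (λ (j : Fin s) → ι s * q)                 ≡⟨ sum-const s (ι s * q) ⟩
      ι s * (ι s * q)                          ∎
      where
      open ≡-Reasoning
      p : Fin s → Fin s → Fin n → ℚ
      p i j z = χ (inv z ∙ ((g ∙ b i) ∙ b j))

    s²≤n : ι s * ι s ≤ ι n
    s²≤n = begin
      ι s * ι s                             ≡⟨ cong (ι s *_) (sym (trans (sum-const s 1ℚ) (*-identityʳ (ι s)))) ⟩
      ι s * sum (λ (j : Fin s) → 1ℚ)        ≡⟨ sym (sum-const s (sum λ (j : Fin s) → 1ℚ)) ⟩
      sum (λ (i : Fin s) → sum λ (j : Fin s) → 1ℚ)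
        ≤⟨ sum-injective-≤ (λ i j → b i ∙ b j) b-S₂ (λ _ → 1ℚ) (λ _ → 0≤1) ⟩
      sum (λ (x : Fin n) → 1ℚ)              ≡⟨ trans (sum-const n 1ℚ) (*-identityʳ (ι n)) ⟩
      ι n                                   ∎
      where open ≤-Reasoning

    ‖Eᵀ‖² : ‖ E ᵀ ‖² ≡ ι n * q
    ‖Eᵀ‖² = begin
      sum (λ g → sum λ y → χ (inv y ∙ g) * χ (inv y ∙ g))
        ≡⟨ sum-cong-≗ (λ g → trans (sum-cong-≗ λ y → 𝟙-idem (lookup H (inv y ∙ g))) (sum-χ-inv g)) ⟩
      sum (λ (g : Fin n) → q)  ≡⟨ sum-const n q ⟩
      ι n * q                  ∎
      where open ≡-Reasoning

    -- λ′, κ and t stand for 1/(nhs), 1/|H| and 1/(4h); λ′ scales M to Hilbert–Schmidt norm at most 1.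
    module _ (η λ′ κ t ε : ℚ) (R : ℕ) (0≤λ : 0ℚ ≤ λ′) (0≤t : 0ℚ ≤ t) (0≤ε : 0ℚ ≤ ε) (1≤η : 1ℚ ≤ η)
      (n≡ηq : ι n ≡ η * q) (λ-inverse : λ′ * (ι n * (η * ι s)) ≡ 1ℚ) (κ-inverse : κ * q ≡ 1ℚ)
      (t-inverse : t * ((η + η) + (η + η)) ≡ 1ℚ) (2η≤s : η + η ≤ ι s)
      (gap : ι n * (ι n - ι s * ι s) ≤ ((ι s * ι s) * (ι s * ι s)) * (ε * ε))
      (Rε≤t : ι R * ε ≤ t) where

      private
        ν σ : ℚ
        ν = ι n
        σ = ι s

        0≤ν : 0ℚ ≤ ν
        0≤ν = ι-nonneg n

        0≤σ : 0ℚ ≤ σ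
        0≤σ = ι-nonneg s

        0≤η : 0ℚ ≤ η
        0≤η = ≤-trans 0≤1 1≤η

      -- `E′` averages over cosets. `D` is the deviation of the products bᵢbⱼ from equidistribution:
      -- σσ is the mean of η · `P g z` over z.
      M E′ D : Mat
      M g y = λ′ * (η * F g y - σ)
      E′ g y = κ * E g y
      D g z = η * P g z - σ * σ

      ‖M‖²≤1 : ‖ M ‖² ≤ 1ℚ
      ‖M‖²≤1 = begin
        ‖ M ‖²                                     ≤⟨ sum-mono (λ g → sum-mono λ y → entry (F-nonneg g y) (F≤s g y)) ⟩
        sum (λ (g : Fin n) → sum λ (y : Fin n) → a)  ≡⟨ sum-cong-≗ {n} (λ g → sum-const n a) ⟩
        sum (λ (g : Fin n) → ν * a)                ≡⟨ sum-const n (ν * a) ⟩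
        ν * (ν * a)                                ≡⟨ collect ν λ′ (η * σ) ⟩
        (λ′ * (ν * (η * σ))) * (λ′ * (ν * (η * σ))) ≡⟨ cong₂ _*_ λ-inverse λ-inverse ⟩
        1ℚ * 1ℚ                                    ≡⟨ *-identityˡ 1ℚ ⟩
        1ℚ                                         ∎
        where
        open ≤-Reasoning
        a = (λ′ * λ′) * ((η * σ) * (η * σ))
        collect : ∀ a b c → a * (a * ((b * b) * (c * c))) ≡ (b * (a * c)) * (b * (a * c))
        collect = solve-∀ ring
        -- Difference of two squares, (ησ)² - (ηf - σ)², split into its two nonnegative factors.
        difference : ∀ l η σ f → (l * l) * ((η * σ) * (η * σ)) ≡
          (l * (η * f - σ)) * (l * (η * f - σ)) +
          (l * l) * ((η * (σ - f) + σ) * ((η - 1ℚ) * σ + η * f))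
        difference = solve-∀ ring
        entry : ∀ {f} → 0ℚ ≤ f → f ≤ σ → (λ′ * (η * f - σ)) * (λ′ * (η * f - σ)) ≤ a
        entry {f} 0≤f f≤σ = ≤-of-≡+
          (*-nonneg (0≤square λ′) (*-nonneg
            (+-nonneg (*-nonneg 0≤η (p≤q⇒0≤q-p f≤σ)) 0≤σ)
            (+-nonneg (*-nonneg (p≤q⇒0≤q-p 1≤η) 0≤σ) (*-nonneg 0≤η 0≤f))))
          (difference λ′ η σ f)

      M⊗E′ : M ⊗ E′ ≐ M
      M⊗E′ g z = begin
        sum (λ y → (λ′ * (η * F g y - σ)) * (κ * E y z))
          ≡⟨ sum-cong-≗ (λ y → expand λ′ η (F g y) σ κ (E y z)) ⟩
        sum (λ y → (λ′ * κ * η) * (F g y * E y z) - (λ′ * κ * σ) * E y z)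
          ≡⟨ sum-- (λ y → (λ′ * κ * η) * (F g y * E y z)) (λ y → (λ′ * κ * σ) * E y z) ⟩
        sum (λ y → (λ′ * κ * η) * (F g y * E y z)) - sum (λ y → (λ′ * κ * σ) * E y z)
          ≡⟨ cong₂ _-_
               (trans (sym (*-distribˡ-sum (λ′ * κ * η) (λ y → F g y * E y z))) (cong ((λ′ * κ * η) *_) (F⊗E g z)))
               (trans (sym (*-distribˡ-sum (λ′ * κ * σ) (λ y → E y z))) (cong ((λ′ * κ * σ) *_) (sum-χ-inv z))) ⟩
        (λ′ * κ * η) * (q * F g z) - (λ′ * κ * σ) * q
          ≡⟨ collect λ′ κ η q (F g z) σ ⟩
        (κ * q) * M g z
          ≡⟨ trans (cong (_* M g z) κ-inverse) (*-identityˡ (M g z)) ⟩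
        M g z ∎
        where
        open ≡-Reasoning
        expand : ∀ l η f σ κ e → (l * (η * f - σ)) * (κ * e) ≡ (l * κ * η) * (f * e) - (l * κ * σ) * e
        expand = solve-∀ ring
        collect : ∀ l κ η q f σ → (l * κ * η) * (q * f) - (l * κ * σ) * q ≡ (κ * q) * (l * (η * f - σ))
        collect = solve-∀ ring

      ‖E′ᵀ‖² : ‖ E′ ᵀ ‖² ≡ η
      ‖E′ᵀ‖² = begin
        sum (λ g → sum λ y → (κ * E y g) * (κ * E y g))
          ≡⟨ sum-cong-≗ (λ g → trans (sum-cong-≗ λ y → square-* κ (E y g))
               (sym (*-distribˡ-sum (κ * κ) (λ y → E y g * E y g)))) ⟩
        sum (λ g → (κ * κ) * sum (λ y → E y g * E y g))
          ≡⟨ sym (*-distribˡ-sum (κ * κ) (λ g → sum λ y → E y g * E y g)) ⟩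
        (κ * κ) * ‖ E ᵀ ‖²
          ≡⟨ cong ((κ * κ) *_) (trans ‖Eᵀ‖² (cong (_* q) n≡ηq)) ⟩
        (κ * κ) * ((η * q) * q)
          ≡⟨ collect κ η q ⟩
        ((κ * q) * (κ * q)) * η
          ≡⟨ cong (λ x → (x * x) * η) κ-inverse ⟩
        (1ℚ * 1ℚ) * η
          ≡⟨ *-identityˡ η ⟩
        η ∎
        where
        open ≡-Reasoning
        collect : ∀ κ η q → (κ * κ) * ((η * q) * q) ≡ ((κ * q) * (κ * q)) * η
        collect = solve-∀ ring

      -- The diagonal bound gives tr M ≤ νλ′(η - σ), and σ ≥ 2η makes this at most -νλ′σ/2 = -1/(2η)
      -- = -2t. Doubling both sides avoids the fraction.
      tr-M : tr M + (t + t) ≤ 0ℚ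
      tr-M = halve (begin
        (tr M + (t + t)) + (tr M + (t + t))
          ≤⟨ +-mono-≤ (+-monoˡ-≤ (t + t) tr≤) (+-monoˡ-≤ (t + t) tr≤) ⟩
        (ν * (λ′ * (η - σ)) + (t + t)) + (ν * (λ′ * (η - σ)) + (t + t))
          ≡⟨ regroup ν λ′ η σ t ⟩
        (ν * λ′) * ((η + η) - (σ + σ)) + 1ℚ * ((t + t) + (t + t))
          ≡⟨ cong (λ x → (ν * λ′) * ((η + η) - (σ + σ)) + x * ((t + t) + (t + t))) (sym λ-inverse) ⟩
        (ν * λ′) * ((η + η) - (σ + σ)) + (λ′ * (ν * (η * σ))) * ((t + t) + (t + t))
          ≡⟨ regroup₂ ν λ′ η σ t ⟩
        (ν * λ′) * ((η + η) - (σ + σ)) + (ν * λ′ * σ) * (t * ((η + η) + (η + η)))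
          ≡⟨ cong (λ x → (ν * λ′) * ((η + η) - (σ + σ)) + (ν * λ′ * σ) * x) t-inverse ⟩
        (ν * λ′) * ((η + η) - (σ + σ)) + (ν * λ′ * σ) * 1ℚ
          ≡⟨ regroup₃ ν λ′ η σ ⟩
        (ν * λ′) * ((η + η) - σ)
          ≤⟨ *-monoˡ (*-nonneg 0≤ν 0≤λ) (≤-trans (+-monoˡ-≤ (- σ) 2η≤s) (≤-reflexive (+-inverseʳ σ))) ⟩
        (ν * λ′) * 0ℚ
          ≡⟨ *-zeroʳ (ν * λ′) ⟩
        0ℚ ∎)
        where
        open ≤-Reasoning
        tr≤ : tr M ≤ ν * (λ′ * (η - σ))
        tr≤ = ≤-trans
          (sum-mono λ g → *-monoˡ 0≤λ (+-monoˡ-≤ (- σ)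
            (≤-trans (*-monoˡ 0≤η (F-diagonal g)) (≤-reflexive (*-identityʳ η)))))
          (≤-reflexive (sum-const n (λ′ * (η - σ))))
        regroup : ∀ ν l η σ t → (ν * (l * (η - σ)) + (t + t)) + (ν * (l * (η - σ)) + (t + t)) ≡
          (ν * l) * ((η + η) - (σ + σ)) + 1ℚ * ((t + t) + (t + t))
        regroup = solve-∀ ring
        regroup₂ : ∀ ν l η σ t → (ν * l) * ((η + η) - (σ + σ)) + (l * (ν * (η * σ))) * ((t + t) + (t + t)) ≡
          (ν * l) * ((η + η) - (σ + σ)) + (ν * l * σ) * (t * ((η + η) + (η + η)))
        regroup₂ = solve-∀ ring
        regroup₃ : ∀ ν l η σ → (ν * l) * ((η + η) - (σ + σ)) + (ν * l * σ) * 1ℚ ≡ (ν * l) * ((η + η) - σ)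
        regroup₃ = solve-∀ ring

      -- All row and column sums of `F` are σq, so the two linear terms and the constant one
      -- collapse into a single -σσ.
      M⊗M : ∀ g z → (M ⊗ M) g z ≡ (λ′ * λ′ * ν) * D g z
      M⊗M g z = begin
        sum (λ y → (λ′ * (η * F g y - σ)) * (λ′ * (η * F y z - σ)))
          ≡⟨ sum-cong-≗ (λ y → expand λ′ η σ (F g y) (F y z)) ⟩
        sum (λ y → (a * (F g y * F y z) - b′ * F g y) - (b′ * F y z - c))
          ≡⟨ sum-- (λ y → a * (F g y * F y z) - b′ * F g y) (λ y → b′ * F y z - c) ⟩
        sum (λ y → a * (F g y * F y z) - b′ * F g y) - sum (λ y → b′ * F y z - c)
          ≡⟨ cong₂ _-_ (sum-- (λ y → a * (F g y * F y z)) (λ y → b′ * F g y)) (sum-- (λ y → b′ * F y z) (λ _ → c)) ⟩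
        (sum (λ y → a * (F g y * F y z)) - sum (λ y → b′ * F g y)) - (sum (λ y → b′ * F y z) - sum {n} (λ _ → c))
          ≡⟨ cong₂ _-_ (cong₂ _-_
               (trans (sym (*-distribˡ-sum a (λ y → F g y * F y z))) (cong (a *_) (F⊗F g z)))
               (trans (sym (*-distribˡ-sum b′ (F g))) (cong (b′ *_) (F-row g))))
               (cong₂ _-_ (trans (sym (*-distribˡ-sum b′ (λ y → F y z))) (cong (b′ *_) (F-column z))) (sum-const n c)) ⟩
        (a * (q * P g z) - b′ * (σ * q)) - (b′ * (σ * q) - ν * c)
          ≡⟨ cong (λ x → (a * (q * P g z) - b′ * (σ * q)) - (b′ * (σ * q) - x * c)) n≡ηq ⟩
        (a * (q * P g z) - b′ * (σ * q)) - (b′ * (σ * q) - (η * q) * c)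
          ≡⟨ collect λ′ η σ q (P g z) ⟩
        (λ′ * λ′ * (η * q)) * D g z
          ≡⟨ cong (λ x → (λ′ * λ′ * x) * D g z) (sym n≡ηq) ⟩
        (λ′ * λ′ * ν) * D g z ∎
        where
        open ≡-Reasoning
        a  = λ′ * λ′ * (η * η)
        b′ = λ′ * λ′ * (η * σ)
        c  = λ′ * λ′ * (σ * σ)
        expand : ∀ l η σ x y → (l * (η * x - σ)) * (l * (η * y - σ)) ≡
          (l * l * (η * η) * (x * y) - l * l * (η * σ) * x) - (l * l * (η * σ) * y - l * l * (σ * σ))
        expand = solve-∀ ring
        collect : ∀ l η σ q p →
          (l * l * (η * η) * (q * p) - l * l * (η * σ) * (σ * q)) - (l * l * (η * σ) * (σ * q) - (η * q) * (l * l * (σ * σ))) ≡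
          (l * l * (η * q)) * (η * p - σ * σ)
        collect = solve-∀ ring

      -- On 0 ≤ x ≤ ν the convex function (x - σσ)² lies below an affine one. Taken at x = η ·
      -- `P g z`, whose mean over z is σσ, the linear part of that bound sums to 0.
      D-row-square : ∀ g → sum (λ z → D g z * D g z) ≤ ν * (ν * (ν - σ * σ))
      D-row-square g = begin
        sum (λ z → D g z * D g z)                           ≤⟨ sum-mono (λ z → pointwise z) ⟩
        sum (λ z → m - (σ * σ) * D g z)                     ≡⟨ sum-- (λ _ → m) (λ z → (σ * σ) * D g z) ⟩
        sum {n} (λ _ → m) - sum (λ z → (σ * σ) * D g z)
          ≡⟨ cong₂ _-_ (sum-const n m) (trans (sym (*-distribˡ-sum (σ * σ) (D g))) (cong ((σ * σ) *_) row)) ⟩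
        ν * m - (σ * σ) * 0ℚ                                ≡⟨ drop (ν * m) (σ * σ) ⟩
        ν * m                                               ∎
        where
        open ≤-Reasoning
        m = ν * (ν - σ * σ)
        drop : ∀ a b → a - b * 0ℚ ≡ a
        drop = solve-∀ ring
        difference : ∀ ν σ x → ν * (ν - σ * σ) - (σ * σ) * (x - σ * σ) ≡
          (x - σ * σ) * (x - σ * σ) + (ν - x) * (x + (ν - σ * σ))
        difference = solve-∀ ring
        pointwise : ∀ z → D g z * D g z ≤ m - (σ * σ) * D g z
        pointwise z = ≤-of-≡+
          (*-nonneg (p≤q⇒0≤q-p (≤-trans (*-monoˡ 0≤η (P≤q g z)) (≤-reflexive (sym n≡ηq))))
                    (+-nonneg (*-nonneg 0≤η (P-nonneg g z)) (p≤q⇒0≤q-p s²≤n)))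
          (difference ν σ (η * P g z))
        vanish : ∀ η σ q → η * (σ * (σ * q)) - (η * q) * (σ * σ) ≡ 0ℚ
        vanish = solve-∀ ring
        row : sum (D g) ≡ 0ℚ
        row = begin-equality
          sum (λ z → η * P g z - σ * σ)                     ≡⟨ sum-- (λ z → η * P g z) (λ _ → σ * σ) ⟩
          sum (λ z → η * P g z) - sum {n} (λ _ → σ * σ)
            ≡⟨ cong₂ _-_ (trans (sym (*-distribˡ-sum η (P g))) (cong (η *_) (P-row g)))
                         (trans (sum-const n (σ * σ)) (cong (_* (σ * σ)) n≡ηq)) ⟩
          η * (σ * (σ * q)) - (η * q) * (σ * σ)             ≡⟨ vanish η σ q ⟩
          0ℚ                                                ∎

      -- The row bounds add up to (λ′ν)⁴ · ν(ν - σσ). By `gap` this is at most (λ′νσ)⁴ε², and λ′νσ =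
      -- 1/η ≤ 1.
      ‖M⊗M‖²≤ : ‖ M ⊗ M ‖² ≤ ε * ε
      ‖M⊗M‖²≤ = begin
        ‖ M ⊗ M ‖²                                          ≡⟨ ⟨⟩-cong M⊗M M⊗M ⟩
        sum (λ g → sum λ z → (a * D g z) * (a * D g z))
          ≡⟨ sum-cong-≗ (λ g → trans (sum-cong-≗ λ z → square-* a (D g z))
               (sym (*-distribˡ-sum (a * a) (λ z → D g z * D g z)))) ⟩
        sum (λ g → (a * a) * sum (λ z → D g z * D g z))
          ≤⟨ sum-mono (λ g → *-monoˡ (0≤square a) (D-row-square g)) ⟩
        sum {n} (λ g → (a * a) * (ν * (ν * (ν - σ * σ))))   ≡⟨ sum-const n _ ⟩
        ν * ((a * a) * (ν * (ν * (ν - σ * σ))))             ≡⟨ regroup λ′ ν (ν * (ν - σ * σ)) ⟩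
        ((λ′ * ν) * (λ′ * ν)) * ((λ′ * ν) * (λ′ * ν)) * (ν * (ν - σ * σ))
          ≤⟨ *-monoˡ (*-nonneg (0≤square (λ′ * ν)) (0≤square (λ′ * ν))) gap ⟩
        ((λ′ * ν) * (λ′ * ν)) * ((λ′ * ν) * (λ′ * ν)) * (((σ * σ) * (σ * σ)) * (ε * ε))
          ≡⟨ regroup₂ (λ′ * ν) σ ε ⟩
        ((x * x) * (x * x)) * (ε * ε)
          ≤⟨ *-monoʳ (0≤square ε) (square-mono (0≤square x) (square-mono 0≤x x≤1)) ⟩
        ((1ℚ * 1ℚ) * (1ℚ * 1ℚ)) * (ε * ε)                   ≡⟨ *-identityˡ (ε * ε) ⟩
        ε * ε                                               ∎
        where
        open ≤-Reasoning
        a = λ′ * λ′ * ν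
        x = λ′ * ν * σ
        regroup : ∀ l ν m → ν * (((l * l * ν) * (l * l * ν)) * (ν * m)) ≡ ((l * ν) * (l * ν)) * ((l * ν) * (l * ν)) * m
        regroup = solve-∀ ring
        regroup₂ : ∀ u σ ε → (u * u) * (u * u) * (((σ * σ) * (σ * σ)) * (ε * ε)) ≡
          (((u * σ) * (u * σ)) * ((u * σ) * (u * σ))) * (ε * ε)
        regroup₂ = solve-∀ ring
        regroup₃ : ∀ l ν σ η → (l * ν * σ) * η ≡ l * (ν * (η * σ))
        regroup₃ = solve-∀ ring
        0≤x : 0ℚ ≤ x
        0≤x = *-nonneg (*-nonneg 0≤λ 0≤ν) 0≤σ
        x≤1 : x ≤ 1ℚ
        x≤1 = begin
          x       ≡⟨ sym (*-identityʳ x) ⟩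
          x * 1ℚ  ≤⟨ *-monoˡ 0≤x 1≤η ⟩
          x * η   ≡⟨ trans (regroup₃ λ′ ν σ η) λ-inverse ⟩
          1ℚ      ∎

      descent-bound : ι R * ((t * t) * (t * t)) ≤ η * η * η
      descent-bound = Descent.nearly-nilpotent⇒small-trace M ‖M‖²≤1 E′ M⊗E′ η (≤-reflexive ‖E′ᵀ‖²)
        ε 0≤ε ‖M⊗M‖²≤ R t Rε≤t tr-M 0≤t

  -- Choice of constants and the bound for S₂-families.

  inverse : ∀ {x} → 0ℚ < x → Σ ℚ λ y → 0ℚ ≤ y × y * x ≡ 1ℚ
  inverse {x} 0<x = 1/ x , <⇒≤ (positive⁻¹ (1/ x) {{1/pos⇒pos x}}) , *-inverseˡ x
    where
    instance
      x-positive : Positive x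
      x-positive = positive 0<x
      x-nonZero : NonZero x
      x-nonZero = pos⇒nonZero x

  0<* : ∀ {x y} → 0ℚ < x → 0ℚ < y → 0ℚ < x * y
  0<* {x} {y} 0<x 0<y = positive⁻¹ (x * y) {{pos*pos⇒pos x {{positive 0<x}} y {{positive 0<y}}}}

  double double² : ℕ → ℕ
  double m = m ℕ.+ m
  double² m = double (double m)

  module Constants (h : ℕ) where
    -- Number of descent steps: exceeds h³ / t⁴ with t = 1 / 4h.
    steps : ℕ
    steps = suc ((h ℕ.* h ℕ.* h) ℕ.* ((double² h ℕ.* double² h) ℕ.* (double² h ℕ.* double² h)))

    -- The reciprocal of the ε of the descent, chosen so that `steps` · ε is exactly t = 1 / 4h.
    accuracy : ℕ
    accuracy = double² h ℕ.* steps

    -- Four times `accuracy` squared. The 4 absorbs the loss in ν² ≤ 4σ⁴ when ν(ν - σσ) is compared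
    -- with σ⁴ε².
    gap : ℕ
    gap = double accuracy ℕ.* double accuracy

    module _ (1≤h : 1 ℕ.≤ h) where
      1≤double : ∀ {m} → 1 ℕ.≤ m → 1 ℕ.≤ double m
      1≤double {m} 1≤m = ℕₚ.≤-trans 1≤m (ℕₚ.m≤m+n m m)

      1≤accuracy : 1 ℕ.≤ accuracy
      1≤accuracy = ℕₚ.*-mono-≤ (1≤double (1≤double 1≤h)) (ℕ.s≤s ℕ.z≤n)

      1≤gap : 1 ℕ.≤ gap
      1≤gap = ℕₚ.*-mono-≤ (1≤double 1≤accuracy) (1≤double 1≤accuracy)

      1≤threshold : 1 ℕ.≤ double² h ℕ.* double h
      1≤threshold = ℕₚ.*-mono-≤ (1≤double (1≤double 1≤h)) (1≤double 1≤h)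

  -- If the bound s² ≤ (1 - 1/(gap + 1)) n failed, all hypotheses of the descent would hold, with
  -- more steps than the norm can pay for. The comparison is decidable, so refuting its failure
  -- suffices.
  sidon-bound : (h : ℕ) → 1 ℕ.≤ h → {n : ℕ} → double² h ℕ.* double h ℕ.≤ n →
    (G : FinGroup n) (H : Subset n) → IsNormalAbelianSubgroup G H → n ≡ h ℕ.* ∣ H ∣ →
    {s : ℕ} (b : Fin s → Fin n) →
    (∀ i j i′ j′ → FinGroup._∙_ G (b i) (b j) ≡ FinGroup._∙_ G (b i′) (b j′) → i ≡ i′ × j ≡ j′) →
    (s ℕ.* s) ℕ.* suc (Constants.gap h) ℕ.≤ Constants.gap h ℕ.* n
  sidon-bound h 1≤h {n} N≤n G H HN n≡h∣H∣ {s} b b-S₂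
    with (s ℕ.* s) ℕ.* suc (Constants.gap h) ℕₚ.≤? Constants.gap h ℕ.* n
  ... | yes bound = bound
  ... | no  large = contradiction 1≤0 (<⇒≱ (positive⁻¹ 1ℚ))
    where
    open Constants h
    open SidonCounting G H HN b b-S₂
    open ≤-Reasoning
    ν σ η θ c ρ : ℚ
    ν = ι n
    σ = ι s
    η = ι h
    θ = (η + η) + (η + η)
    c = ι accuracy
    ρ = ι steps

    ι-double : ∀ m → ι (double m) ≡ ι m + ι m
    ι-double m = ι-+ m m

    ι-double² : ∀ m → ι (double² m) ≡ (ι m + ι m) + (ι m + ι m)
    ι-double² m = trans (ι-double (double m)) (cong₂ _+_ (ι-double m) (ι-double m))

    θ≡ : ι (double² h) ≡ θ
    θ≡ = ι-double² h

    c≡ : c ≡ θ * ρ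
    c≡ = trans (ι-* (double² h) steps) (cong (_* ρ) θ≡)

    ρ≡ : ρ ≡ 1ℚ + (η * η * η) * ((θ * θ) * (θ * θ))
    ρ≡ = cong (1ℚ +_) (trans (ι-* (h ℕ.* h ℕ.* h) _) (cong₂ _*_
      (trans (ι-* (h ℕ.* h) h) (cong (_* η) (ι-* h h)))
      (trans (ι-* (double² h ℕ.* double² h) _) (cong₂ _*_ θθ≡ θθ≡))))
      where
      θθ≡ : ι (double² h ℕ.* double² h) ≡ θ * θ
      θθ≡ = trans (ι-* (double² h) _) (cong₂ _*_ θ≡ θ≡)

    gap≡ : ι gap ≡ (c + c) * (c + c)
    gap≡ = trans (ι-* (double accuracy) _) (cong₂ _*_ (ι-double accuracy) (ι-double accuracy))

    1≤n : 1 ℕ.≤ n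
    1≤n = ℕₚ.≤-trans (1≤threshold 1≤h) N≤n

    0<η : 0ℚ < η
    0<η = ι-pos 1≤h

    1≤η : 1ℚ ≤ η
    1≤η = ι-mono 1≤h

    n≡ηq : ν ≡ η * q
    n≡ηq = trans (cong ι n≡h∣H∣) (ι-* h ∣ H ∣)

    0<∣H∣ : ∀ m → 1 ℕ.≤ h ℕ.* m → 1 ℕ.≤ m
    0<∣H∣ zero    1≤0 = subst (1 ℕ.≤_) (ℕₚ.*-zeroʳ h) 1≤0
    0<∣H∣ (suc m) _   = ℕ.s≤s ℕ.z≤n

    0<q : 0ℚ < q
    0<q = ι-pos (0<∣H∣ ∣ H ∣ (subst (1 ℕ.≤_) n≡h∣H∣ 1≤n))

    d : ℚ
    d = ν - σ * σ

    0≤d : 0ℚ ≤ d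
    0≤d = p≤q⇒0≤q-p s²≤n

    d-gap≤ : d * (1ℚ + ι gap) ≤ ν
    d-gap≤ = begin
      d * (1ℚ + ι gap)                                ≡⟨ expand ν (σ * σ) (ι gap) ⟩
      ι gap * ν + (ν - (σ * σ) * (1ℚ + ι gap))        ≤⟨ +-monoˡ-≤ _ large′ ⟩
      (σ * σ) * (1ℚ + ι gap) + (ν - (σ * σ) * (1ℚ + ι gap)) ≡⟨ cancel ν ((σ * σ) * (1ℚ + ι gap)) ⟩
      ν                                               ∎
      where
      expand : ∀ a b k → (a - b) * (1ℚ + k) ≡ k * a + (a - b * (1ℚ + k))
      expand = solve-∀ ring
      cancel : ∀ a b → b + (a - b) ≡ a
      cancel = solve-∀ ring
      large′ : ι gap * ν ≤ (σ * σ) * (1ℚ + ι gap)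
      large′ = begin
        ι gap * ν                        ≡⟨ sym (ι-* gap n) ⟩
        ι (gap ℕ.* n)                    ≤⟨ ι-mono (ℕₚ.<⇒≤ (ℕₚ.≰⇒> large)) ⟩
        ι ((s ℕ.* s) ℕ.* suc gap)        ≡⟨ trans (ι-* (s ℕ.* s) (suc gap)) (cong (_* ι (suc gap)) (ι-* s s)) ⟩
        (σ * σ) * (1ℚ + ι gap)           ∎

    -- Since `gap` is at least 1, the deficit `d` is at most half of ν.
    ν≤2σ² : ν ≤ σ * σ + σ * σ
    ν≤2σ² = begin
      ν                                        ≡⟨ split ν (σ * σ) ⟩
      (d + d) + (σ * σ + σ * σ - ν)            ≤⟨ +-monoˡ-≤ _ 2d≤ν ⟩
      ν + (σ * σ + σ * σ - ν)                  ≡⟨ cancel ν (σ * σ) ⟩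
      σ * σ + σ * σ                            ∎
      where
      split : ∀ a b → a ≡ ((a - b) + (a - b)) + (b + b - a)
      split = solve-∀ ring
      cancel : ∀ a b → a + (b + b - a) ≡ b + b
      cancel = solve-∀ ring
      twice : ∀ a → a + a ≡ a * (1ℚ + 1ℚ)
      twice = solve-∀ ring
      2d≤ν : d + d ≤ ν
      2d≤ν = begin
        d + d              ≡⟨ twice d ⟩
        d * (1ℚ + 1ℚ)      ≤⟨ *-monoˡ 0≤d (+-monoʳ-≤ 1ℚ (ι-mono (1≤gap 1≤h))) ⟩
        d * (1ℚ + ι gap)   ≤⟨ d-gap≤ ⟩
        ν                  ∎

    0≤η = <⇒≤ 0<η

    -- Origin of the threshold 8h² on n: together with ν ≤ 2σ² it gives (2h)² ≤ σ².
    2η≤σ : η + η ≤ σ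
    2η≤σ = square-cancel-≤ (ι-nonneg s) (halve (begin
      (η + η) * (η + η) + (η + η) * (η + η)   ≡⟨ sym (*-distribʳ-+ (η + η) (η + η) (η + η)) ⟩
      θ * (η + η)                             ≡⟨ sym (trans (ι-* (double² h) (double h)) (cong₂ _*_ θ≡ (ι-double h))) ⟩
      ι (double² h ℕ.* double h)              ≤⟨ ι-mono N≤n ⟩
      ν                                       ≤⟨ ν≤2σ² ⟩
      σ * σ + σ * σ                           ∎))

    0<σ : 0ℚ < σ
    0<σ = <-≤-trans 0<η (≤-trans (≤-of-≡+ 0≤η refl) 2η≤σ)

    0<θ : 0ℚ < θ
    0<θ = <-≤-trans 0<η (≤-trans (≤-of-≡+ 0≤η refl) (≤-of-≡+ (+-nonneg 0≤η 0≤η) refl))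

    λ-inverse = inverse (0<* (ι-pos 1≤n) (0<* 0<η 0<σ))
    κ-inverse = inverse 0<q
    t-inverse = inverse 0<θ
    ε-inverse = inverse (ι-pos (1≤accuracy 1≤h))
    t = proj₁ t-inverse
    ε = proj₁ ε-inverse
    εc≡1 : ε * c ≡ 1ℚ
    εc≡1 = proj₂ (proj₂ ε-inverse)
    tθ≡1 : t * θ ≡ 1ℚ
    tθ≡1 = proj₂ (proj₂ t-inverse)

    gap≤ : ν * d ≤ ((σ * σ) * (σ * σ)) * (ε * ε)
    gap≤ = begin
      ν * d                            ≡⟨ sym (*-identityʳ (ν * d)) ⟩
      (ν * d) * (1ℚ * 1ℚ)              ≡⟨ cong (λ x → (ν * d) * (x * x)) (sym εc≡1) ⟩
      (ν * d) * ((ε * c) * (ε * c))    ≡⟨ regroup ν d ε c ⟩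
      (ν * d * (c * c)) * (ε * ε)      ≤⟨ *-monoʳ (0≤square ε) bound ⟩
      ((σ * σ) * (σ * σ)) * (ε * ε)    ∎
      where
      regroup : ∀ ν d ε c → (ν * d) * ((ε * c) * (ε * c)) ≡ (ν * d * (c * c)) * (ε * ε)
      regroup = solve-∀ ring
      expand : ∀ ν d c → (ν * d * (c * c) + ν * d * (c * c)) + (ν * d * (c * c) + ν * d * (c * c)) ≡ ν * (d * ((c + c) * (c + c)))
      expand = solve-∀ ring
      collect : ∀ a → (a + a) * (a + a) ≡ (a * a + a * a) + (a * a + a * a)
      collect = solve-∀ ring
      fourfold : (ν * d * (c * c) + ν * d * (c * c)) + (ν * d * (c * c) + ν * d * (c * c)) ≤
        ((σ * σ) * (σ * σ) + (σ * σ) * (σ * σ)) + ((σ * σ) * (σ * σ) + (σ * σ) * (σ * σ))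
      fourfold = begin
        _                                            ≡⟨ expand ν d c ⟩
        ν * (d * ((c + c) * (c + c)))                ≡⟨ cong (λ x → ν * (d * x)) (sym gap≡) ⟩
        ν * (d * ι gap)                              ≤⟨ *-monoˡ (ι-nonneg n) (*-monoˡ 0≤d (≤-of-≡+ 0≤1 (+-comm 1ℚ (ι gap)))) ⟩
        ν * (d * (1ℚ + ι gap))                       ≤⟨ *-monoˡ (ι-nonneg n) d-gap≤ ⟩
        ν * ν                                        ≤⟨ square-mono (ι-nonneg n) ν≤2σ² ⟩
        (σ * σ + σ * σ) * (σ * σ + σ * σ)            ≡⟨ collect (σ * σ) ⟩
        _                                            ∎
      bound : ν * d * (c * c) ≤ (σ * σ) * (σ * σ)
      bound = halve (halve fourfold)

    ρε≤t : ρ * ε ≤ t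
    ρε≤t = ≤-reflexive (begin-equality
      ρ * ε              ≡⟨ sym (*-identityˡ (ρ * ε)) ⟩
      1ℚ * (ρ * ε)       ≡⟨ cong (_* (ρ * ε)) (sym tθ≡1) ⟩
      (t * θ) * (ρ * ε)  ≡⟨ regroup t θ ρ ε ⟩
      t * (ε * (θ * ρ))  ≡⟨ cong (λ x → t * (ε * x)) (sym c≡) ⟩
      t * (ε * c)        ≡⟨ cong (t *_) εc≡1 ⟩
      t * 1ℚ             ≡⟨ *-identityʳ t ⟩
      t                  ∎)
      where
      regroup : ∀ t θ ρ ε → (t * θ) * (ρ * ε) ≡ t * (ε * (θ * ρ))
      regroup = solve-∀ ring

    t⁴ θ⁴ η³ : ℚ
    t⁴ = (t * t) * (t * t)
    θ⁴ = (θ * θ) * (θ * θ)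
    η³ = η * η * η

    t⁴θ⁴≡1 : t⁴ * θ⁴ ≡ 1ℚ
    t⁴θ⁴≡1 = trans (regroup t θ) (cong (λ x → (x * x) * (x * x)) tθ≡1)
      where
      regroup : ∀ t θ → ((t * t) * (t * t)) * ((θ * θ) * (θ * θ)) ≡ ((t * θ) * (t * θ)) * ((t * θ) * (t * θ))
      regroup = solve-∀ ring

    ρt⁴≤η³ : ρ * t⁴ ≤ η³
    ρt⁴≤η³ = descent-bound η (proj₁ λ-inverse) (proj₁ κ-inverse) t ε steps
      (proj₁ (proj₂ λ-inverse)) (proj₁ (proj₂ t-inverse)) (proj₁ (proj₂ ε-inverse)) 1≤η n≡ηq
      (proj₂ (proj₂ λ-inverse)) (proj₂ (proj₂ κ-inverse)) tθ≡1 2η≤σ gap≤ ρε≤t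

    -- As tθ = 1 and ρ = 1 + η³θ⁴, the product ρt⁴ equals t⁴ + η³. The successor in `steps` thus
    -- leaves t⁴ over against the bound η³.
    t⁴≤0 : t⁴ ≤ 0ℚ
    t⁴≤0 = begin
      t⁴                           ≡⟨ split t⁴ η³ θ⁴ ⟩
      (1ℚ + η³ * θ⁴) * t⁴ - η³ * (t⁴ * θ⁴) ≡⟨ cong₂ _-_ (cong (_* t⁴) (sym ρ≡)) (trans (cong (η³ *_) t⁴θ⁴≡1) (*-identityʳ η³)) ⟩
      ρ * t⁴ - η³                  ≤⟨ +-monoˡ-≤ (- η³) ρt⁴≤η³ ⟩
      η³ - η³                      ≡⟨ +-inverseʳ η³ ⟩
      0ℚ                           ∎
      where
      split : ∀ t η θ → t ≡ (1ℚ + η * θ) * t - η * (t * θ)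
      split = solve-∀ ring

    1≤0 : 1ℚ ≤ 0ℚ
    1≤0 = begin
      1ℚ       ≡⟨ sym t⁴θ⁴≡1 ⟩
      t⁴ * θ⁴  ≤⟨ *-monoʳ (0≤square (θ * θ)) t⁴≤0 ⟩
      0ℚ * θ⁴  ≡⟨ *-zeroˡ θ⁴ ⟩
      0ℚ       ∎

open Rational using (module Constants; double; double²; sidon-bound)
open import Data.Nat using (ℕ; _+_; _*_; _^_; _∸_; _≤_; _<_)
open import Data.Nat.Divisibility using (_∣_; divides)

-- Reduction to k = 2

enumerate : ∀ {n} (A : Subset n) → Fin ∣ A ∣ → Fin n
enumerate (true  ∷ A) zero    = zero
enumerate (true  ∷ A) (suc i) = suc (enumerate A i)
enumerate (false ∷ A) i       = suc (enumerate A i)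

enumerate-∈ : ∀ {n} (A : Subset n) i → enumerate A i ∈ A
enumerate-∈ (true  ∷ A) zero    = here
enumerate-∈ (true  ∷ A) (suc i) = there (enumerate-∈ A i)
enumerate-∈ (false ∷ A) i       = there (enumerate-∈ A i)

enumerate-injective : ∀ {n} (A : Subset n) {i j} → enumerate A i ≡ enumerate A j → i ≡ j
enumerate-injective (true  ∷ A) {zero}  {zero}  _  = refl
enumerate-injective (true  ∷ A) {suc i} {suc j} eq = cong suc (enumerate-injective A (suc-injective eq))
enumerate-injective (false ∷ A) eq = enumerate-injective A (suc-injective eq)

finToFun-injective : ∀ {m} l {i j : Fin (m ^ l)} → finToFun i ≗ finToFun j → i ≡ j
finToFun-injective {m} l {i} {j} eq = begin
  i                              ≡⟨ sym (funToFin-finToFin {l} {m} i) ⟩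
  funToFin (finToFun {m} {l} i)  ≡⟨ funToFin-cong l eq ⟩
  funToFin (finToFun {m} {l} j)  ≡⟨ funToFin-finToFin {l} {m} j ⟩
  j                              ∎
  where
  open ≡-Reasoning
  funToFin-cong : ∀ l {f g : Fin l → Fin m} → f ≗ g → funToFin f ≡ funToFin g
  funToFin-cong zero    f≗g = refl
  funToFin-cong (suc l) f≗g = cong₂ combine (f≗g zero) (funToFin-cong l (f≗g ∘ suc))

module Words {n : ℕ} (G : FinGroup n) where
  open FinGroup G
  open IsGroup isGroup using (assoc; identityˡ)

  prod-cong : ∀ l {a b : Fin l → Fin n} → a ≗ b → prod G l a ≡ prod G l b
  prod-cong zero    a≗b = refl
  prod-cong (suc l) a≗b = cong₂ _∙_ (a≗b zero) (prod-cong l (a≗b ∘ suc))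

  ++-suc : ∀ {l m} (a : Fin (suc l) → Fin n) (b : Fin m → Fin n) i → (a ++ b) (suc i) ≡ ((a ∘ suc) ++ b) i
  ++-suc {l} a b i with splitAt l i
  ... | inj₁ _ = refl
  ... | inj₂ _ = refl

  prod-++ : ∀ l m (a : Fin l → Fin n) (b : Fin m → Fin n) →
    prod G (l + m) (a ++ b) ≡ prod G l a ∙ prod G m b
  prod-++ zero    m a b = sym (identityˡ (prod G m b))
  prod-++ (suc l) m a b = begin
    a zero ∙ prod G (l + m) (λ i → (a ++ b) (suc i))
      ≡⟨ cong (a zero ∙_) (trans (prod-cong (l + m) (++-suc a b)) (prod-++ l m (a ∘ suc) b)) ⟩
    a zero ∙ (prod G l (a ∘ suc) ∙ prod G m b)
      ≡⟨ sym (assoc (a zero) (prod G l (a ∘ suc)) (prod G m b)) ⟩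
    prod G (suc l) a ∙ prod G m b ∎
    where open ≡-Reasoning

  module _ (A : Subset n) (m : ℕ) where
    -- Words are coded by numbers so that the size s of the family is `∣ A ∣ ^ m` by definition.
    word : Fin (∣ A ∣ ^ m) → Fin m → Fin n
    word w i = enumerate A (finToFun w i)

    word-injective : ∀ {v w} → word v ≗ word w → v ≡ w
    word-injective eq = finToFun-injective m (enumerate-injective A ∘ eq)

    -- Two words of length m concatenate to one of length 2m, whose letters the S_k property
    -- recovers from the product. The family is indexed by words, so distinctness of their products
    -- need not be proved separately.
    word-prod-S₂ : IsSk G (m + m) A → ∀ v w v′ w′ →
      prod G m (word v) ∙ prod G m (word w) ≡ prod G m (word v′) ∙ prod G m (word w′) → v ≡ v′ × w ≡ w′
    word-prod-S₂ A-S v w v′ w′ eq =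
      word-injective (++-injectiveˡ (word v) (word v′) letters) ,
      word-injective (++-injectiveʳ (word v) (word v′) letters)
      where
      word++-∈ : ∀ v w i → (word v ++ word w) i ∈ A
      word++-∈ v w i with splitAt m i
      ... | inj₁ j = enumerate-∈ A (finToFun v j)
      ... | inj₂ j = enumerate-∈ A (finToFun w j)
      letters : word v ++ word w ≗ word v′ ++ word w′
      letters = A-S _ _ (word++-∈ v w) (word++-∈ v′ w′)
        (trans (prod-++ m m (word v) (word w)) (trans eq (sym (prod-++ m m (word v′) (word w′)))))

-- From a bound on the k-th power to a factor 1 - ε.

-- (1 - 1/(r+1))^k ≥ 1 - k/(r+1), cleared of denominators so that it lives in ℕ.
bernoulli : ∀ r k → suc r ^ k * suc r ≤ r ^ k * suc r + k * suc r ^ k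
bernoulli r zero    = ℕₚ.m≤m+n _ _
bernoulli r (suc k) = begin
  suc r * u * suc r                                    ≡⟨ ℕₚ.*-assoc (suc r) u (suc r) ⟩
  suc r * (u * suc r)                                  ≤⟨ ℕₚ.*-monoʳ-≤ (suc r) (bernoulli r k) ⟩
  suc r * (v * suc r + k * u)                      ≡⟨ expand r u v k ⟩
  r * v * suc r + k * (suc r * u) + suc r * v
    ≤⟨ ℕₚ.+-monoʳ-≤ (r * v * suc r + k * (suc r * u)) (ℕₚ.*-monoʳ-≤ (suc r) (ℕₚ.^-monoˡ-≤ k (ℕₚ.n≤1+n r))) ⟩
  r * v * suc r + k * (suc r * u) + suc r * u ≡⟨ collect (r * v * suc r) k (suc r * u) ⟩
  r * v * suc r + (suc r * u + k * (suc r * u)) ∎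
  where
  open ℕₚ.≤-Reasoning
  u = suc r ^ k
  v = r ^ k
  expand : ∀ r u v k → suc r * (v * suc r + k * u) ≡ r * v * suc r + k * (suc r * u) + suc r * v
  expand = ℕ-solver.solve-∀
  collect : ∀ a k b → a + k * b + b ≡ a + (b + k * b)
  collect = ℕ-solver.solve-∀

-- Bernoulli with r + 1 = k(K + 1) gives (1 - 1/(k(K+1)))^k ≥ 1 - 1/(K+1) = K/(K+1), the factor in
-- the hypothesis.
rescale : ∀ k → 1 ≤ k → ∀ K a n → a ^ k * suc K ≤ K * n →
  a ^ k * (k * suc K) ^ k ≤ (k * suc K ∸ 1) ^ k * n
rescale k@(suc k′) 1≤k K a n aK≤ = ℕₚ.*-cancelʳ-≤ _ _ (suc K) (begin
  A * u * suc K          ≡⟨ swap A u (suc K) ⟩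
  A * suc K * u          ≤⟨ ℕₚ.*-monoˡ-≤ u aK≤ ⟩
  K * n * u              ≡⟨ swap K n u ⟩
  K * u * n              ≤⟨ ℕₚ.*-monoˡ-≤ n Ku≤ ⟩
  v * suc K * n          ≡⟨ swap v (suc K) n ⟩
  v * n * suc K          ∎)
  where
  open ℕₚ.≤-Reasoning
  A = a ^ k
  u = (k * suc K) ^ k
  v = (k * suc K ∸ 1) ^ k
  swap : ∀ a b c → a * b * c ≡ a * c * b
  swap = ℕ-solver.solve-∀
  expand : ∀ k K u → k * (K * u) + k * u ≡ u * (k * suc K)
  expand = ℕ-solver.solve-∀
  collect : ∀ k K v → v * (k * suc K) ≡ k * (v * suc K)
  collect = ℕ-solver.solve-∀
  Ku≤ : K * u ≤ v * suc K
  Ku≤ = ℕₚ.*-cancelˡ-≤ k (ℕₚ.+-cancelʳ-≤ (k * u) _ _ (begin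
    k * (K * u) + k * u           ≡⟨ expand k K u ⟩
    u * (k * suc K)                   ≤⟨ bernoulli (k * suc K ∸ 1) k ⟩
    v * (k * suc K) + k * u       ≡⟨ cong (_+ k * u) (collect k K v) ⟩
    k * (v * suc K) + k * u       ∎))

theorem1p10 : (h : ℕ) → 1 ≤ h → (k : ℕ) → 1 ≤ k → 2 ∣ k →
    Σ ℕ λ p → Σ ℕ λ q → (0 < p) × (p < q) × Σ ℕ λ N →
    (n : ℕ) → N ≤ n → (G : FinGroup n) → (H : Subset n) →
    IsNormalAbelianSubgroup G H → n ≡ h * ∣ H ∣ →
    (A : Subset n) → IsSk G k A →
    ∣ A ∣ ^ k * q ^ k ≤ (q ∸ p) ^ k * n
theorem1p10 h 1≤h k 1≤k (divides m refl) =
  -- ε = 1/(k(K + 1)), the value that `rescale` calls for, and N = 8h². That p < q uses K ≥ 1.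
  1 , k * suc K , ℕ.s≤s ℕ.z≤n , ℕₚ.*-mono-≤ 1≤k (ℕ.s≤s 1≤K) , double² h * double h , main
  where
  K = Constants.gap h
  1≤K = Constants.1≤gap h 1≤h
  m*2≡m+m : m * 2 ≡ m + m
  m*2≡m+m = trans (ℕₚ.*-comm m 2) (cong (m +_) (ℕₚ.+-identityʳ m))
  main : ∀ n → double² h * double h ≤ n → (G : FinGroup n) (H : Subset n) →
    IsNormalAbelianSubgroup G H → n ≡ h * ∣ H ∣ → (A : Subset n) → IsSk G (m * 2) A →
    ∣ A ∣ ^ (m * 2) * (m * 2 * suc K) ^ (m * 2) ≤ (m * 2 * suc K ∸ 1) ^ (m * 2) * n
  main n N≤n G H HN n≡ A A-S = rescale (m * 2) 1≤k K ∣ A ∣ n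
    (subst (λ x → x * suc K ≤ K * n) ∣A∣^m² bound)
    where
    open Words G
    ∣A∣^m² : ∣ A ∣ ^ m * ∣ A ∣ ^ m ≡ ∣ A ∣ ^ (m * 2)
    ∣A∣^m² = trans (sym (ℕₚ.^-distribˡ-+-* ∣ A ∣ m m)) (cong (∣ A ∣ ^_) (sym m*2≡m+m))
    bound : (∣ A ∣ ^ m * ∣ A ∣ ^ m) * suc K ≤ K * n
    bound = sidon-bound h 1≤h N≤n G H HN n≡ (λ w → prod G m (word A m w))
      (word-prod-S₂ A m (subst (λ k → IsSk G k A) m*2≡m+m A-S))
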